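{- Let $G$ be a simple graph with vertex set $\{1,\ldots,n\}$ and let $m\ge 2$ be an integer. Then $$\det W_Q(G\circ P_m)=\pm\,(\det Q(G))^{m-1}\,(\det W_Q(G))^m,$$ i.e. the two sides are equal up to sign.
   Context: For a graph $H$ on $N$ vertices with adjacency matrix $A(H)$ and diagonal degree matrix $D(H)$, the signless Laplacian matrix is $Q(H)=A(H)+D(H)$, and the $Q$-walk matrix is the $N\times N$ matrix $W_Q(H)=[e,Q(H)e,\ldots,Q(H)^{N-1}e]$, where $e\in\mathbb{R}^N$ is the all-one vector. $P_m$ is the path on $m$ vertices, rooted at an endvertex. The rooted product $G\circ P_m$ is the graph on $mn$ vertices obtained from $G$ and $n$ disjoint copies of $P_m$ by identifying, for each $i=1,\ldots,n$, vertex $i$ of $G$ with the root of the $i$-th copy of $P_m$. (Relabeling vertices changes $\det W_Q$ at most by a sign.) -}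

module Defs where

open import Data.Bool.Base using (if_then_else_)
open import Data.Fin.Base using (Fin; zero; suc; toℕ; punchIn; remQuot)
open import Data.Fin.Properties using (_≟_)
open import Data.Integer.Base using (ℤ; 0ℤ; 1ℤ; -1ℤ; +_; _+_; _*_; _^_)
open import Data.Integer.Properties using (+-0-commutativeMonoid)
open import Data.Nat.Base as ℕ using (ℕ; zero; suc)
import Data.Nat.Properties as ℕ
open import Data.Nat.GeneralisedArithmetic using (fold)
open import Data.Product.Base using (_×_; _,_; proj₁; proj₂)
open import Data.Sum.Base as Sum using (_⊎_; inj₁; inj₂)
open import Data.Vec.Base using (count; allFin)
open import Data.Vec.Functional using (Vector; replicate)
open import Level using (0ℓ)
open import Relation.Binary.Core using (Rel)
open import Relation.Binary.Definitions using (Decidable; Symmetric; Irreflexive)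
open import Relation.Binary.PropositionalEquality using (_≡_; refl; sym; trans)
open import Relation.Nullary.Decidable using (does; _×-dec_; _⊎-dec_)

open import Algebra.Properties.CommutativeMonoid.Sum +-0-commutativeMonoid
  using (sum)

Matrix : ℕ → ℕ → Set
Matrix m n = Vector (Vector ℤ n) m

infixl 6 _⊕_
_⊕_ : ∀ {m n} → Matrix m n → Matrix m n → Matrix m n
(A ⊕ B) i j = A i j + B i j

infixr 7 _·_
_·_ : ∀ {m n} → Matrix m n → Vector ℤ n → Vector ℤ m
(A · v) i = sum (λ j → A i j * v j)

-- Laplace expansion along the first row; the empty determinant is 1.
det : ∀ {n} → Matrix n n → ℤ
det {zero}  A = 1ℤ
det {suc n} A =
  sum (λ j → -1ℤ ^ toℕ j * A zero j * det (λ k l → A (suc k) (punchIn j l)))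

-- Decidability of adjacency is automatic classically; it is what makes the
-- 0/1 adjacency matrix definable.
record Graph (n : ℕ) : Set₁ where
  field
    Adj    : Rel (Fin n) 0ℓ
    adj?   : Decidable Adj
    symm   : Symmetric Adj
    irrefl : Irreflexive _≡_ Adj

module _ {n} (G : Graph n) where
  open Graph G

  adjacencyMatrix : Matrix n n
  adjacencyMatrix i j = if does (adj? i j) then 1ℤ else 0ℤ

  degree : Fin n → ℕ
  degree i = count (adj? i) (allFin n)

  degreeMatrix : Matrix n n
  degreeMatrix i j = if does (i ≟ j) then + degree i else 0ℤ

  signlessLaplacian : Matrix n n
  signlessLaplacian = adjacencyMatrix ⊕ degreeMatrix

  -- Column k is Qᵏ e.
  Q-walkMatrix : Matrix n n
  Q-walkMatrix i k = fold (replicate n 1ℤ) (signlessLaplacian ·_) (toℕ k) i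

path : ∀ m → Graph m
path m = record
  { Adj    = λ i j → suc (toℕ i) ≡ toℕ j ⊎ suc (toℕ j) ≡ toℕ i
  ; adj?   = λ i j → (suc (toℕ i) ℕ.≟ toℕ j) ⊎-dec (suc (toℕ j) ℕ.≟ toℕ i)
  ; symm   = Sum.swap
  ; irrefl = λ { refl (inj₁ p) → ℕ.1+n≢n p ; refl (inj₂ p) → ℕ.1+n≢n p }
  }

-- The rooted product of G and (H , r).  The vertex of Fin (m ℕ.* n) that
-- remQuot sends to (a , i) is vertex a of the i-th copy of H; (r , i) is the
-- vertex identified with vertex i of G.
module _ {n m} (G : Graph n) (H : Graph m) (r : Fin m) where
  private
    module G = Graph G
    module H = Graph H

    _~_ : Rel (Fin m × Fin n) 0ℓ
    (a , i) ~ (b , j) =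
      (a ≡ r × b ≡ r × G.Adj i j) ⊎ (i ≡ j × H.Adj a b)

    _~?_ : Decidable _~_
    (a , i) ~? (b , j) =
      ((a ≟ r) ×-dec (b ≟ r) ×-dec G.adj? i j) ⊎-dec ((i ≟ j) ×-dec H.adj? a b)

    ~-sym : Symmetric _~_
    ~-sym (inj₁ (p , q , e)) = inj₁ (q , p , G.symm e)
    ~-sym (inj₂ (p , e))     = inj₂ (sym p , H.symm e)

    ~-irrefl : Irreflexive _≡_ _~_
    ~-irrefl refl (inj₁ (_ , _ , e)) = G.irrefl refl e
    ~-irrefl refl (inj₂ (_ , e))     = H.irrefl refl e

  rootedProduct : Graph (m ℕ.* n)
  rootedProduct = record
    { Adj    = λ x y → remQuot n x ~ remQuot n y
    ; adj?   = λ x y → remQuot n x ~? remQuot n y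
    ; symm   = λ {x} {y} → ~-sym {remQuot n x} {remQuot n y}
    ; irrefl = λ { {x} refl → ~-irrefl {remQuot n x} refl }
    }

{-# OPTIONS --safe #-}
module Submission where

-- Write m = k + 2, N = m n, Q = Q(G), and let the signless Laplacian of the
-- rooted product act on the integer vectors of length N, viewed as m layers
-- of length n.  It is T = E ⊗ Q + L ⊗ 1, where E is the matrix unit at the
-- root and L is the signless Laplacian of the path; it commutes with
-- X = 1 ⊗ Q, and all computations take place in the commutative ring of the
-- polynomials in T and X.
--
-- Number the layers 0, ..., m - 1 from the free end of the path to the root
-- and let w_l be the vector w placed in layer l.  The three-term recurrence of
-- the path gives polynomials ψ_l, monic of degree l, with ψ_l(T) w_0 = w_l
-- (ψ-layer), and the next polynomial φ of that recurrence, monic of degree m,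
-- satisfies the fundamental relation φ(T) = X u with u = ψ_{m-1}(T)
-- (φ≋xψ).  The Euclidean algorithm, run through the recurrence, writes every
-- polynomial of degree less than m as φ q + u r; in particular u is a unit of
-- the ring.
--
-- Since the sign does not matter, determinants are compared up to mutual
-- divisibility: if the columns of B are integer combinations of the columns of
-- A, then det A divides det B (det-∣-det).  The all-one vector is
-- (ψ_0 + ... + ψ_{m-1})(T) applied to e = 1_0, so det W_Q of the rooted
-- product is the product of the following two determinants.
--
-- (1) The determinant of the vectors T^i e, i < N (det-layerWalk).  Every
-- polynomial in T of degree less than N is u^{n-1} times an integer combination
-- of X^j T^a, j < n, a < m, and conversely u^{n-1} X^j T^a has degree less than
-- N in T, because X u = φ.  As u is a unit, T^i e may be replaced by
-- X^j ψ_a(T) e, that is, by Q^j 1 placed in layer a.  The matrix of these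
-- vectors is block diagonal with m blocks W_Q(G).
--
-- (2) The determinant of ψ_0 + ... + ψ_{m-1} (det-Σψ).  This sum is a product of
-- two monic divisors h of φ, whose degrees add up to m - 1 (Σψ-factors); with
-- T = z², it is the square of the Chebyshev polynomial S_{m-1}(z).  Let h have
-- degree d and φ = h c.  Then h T^i, i < m - d, together with
-- h c T^j = X u T^j, j < d, span the multiples of h, while h T^i and u T^j
-- together span everything over the polynomials in X (generates-everything).
-- Hence the determinant of h(T) is that of X on d layers, (det Q)^d
-- (det-divisor).

open import Defs
open import Algebra.Bundles using (CommutativeRing; module CommutativeRing)
import Algebra.Properties.Ring
import Algebra.Properties.Semiring.Exp
import Algebra.Properties.Semiring.Sum
import Algebra.Solver.Ring
open import Algebra.Solver.Ring.AlmostCommutativeRing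
  using (_-Raw-AlmostCommutative⟶_; fromCommutativeRing; module _-Raw-AlmostCommutative⟶_)
open import Data.Bool.Base using (true; false; if_then_else_)
open import Data.Fin.Base
  using (Fin; zero; suc; toℕ; fromℕ<; inject₁; punchIn; punchOut; pinch; opposite;
         _↑ˡ_; _↑ʳ_; combine; quotient; remainder)
open import Data.Fin.Induction using (<-weakInduction)
open import Data.Fin.Properties as Fin
  using (_≟_; toℕ<n; toℕ-fromℕ<; toℕ-injective; toℕ-inject₁; nonZeroIndex; opposite-prop;
         punchInᵢ≢i; punchIn-punchOut; suc-injective; remQuot-combine; combine-remQuot; combine-injective)
open import Data.Integer.Base as ℤ using (ℤ; 0ℤ; 1ℤ; -1ℤ; +-*-rawRing)
open import Data.Integer.Divisibility.Signed using (_∣_; divides; ∣-trans; ∣-reflexive; ∣⇒∣ᵤ)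
import Data.Integer.Properties as ℤ
open import Data.Integer.Tactic.RingSolver using (solve-∀)
open import Data.Maybe.Base using (Maybe; just; nothing)
open import Data.Nat.Base as ℕ using (ℕ; zero; suc; pred; z≤n; s≤s; _<_; _≤_; _∸_)
import Data.Nat.Divisibility as ℕ using (∣-antisym)
open import Data.Nat.GeneralisedArithmetic using (fold)
import Data.Nat.Properties as ℕ
open import Data.Nat.Properties using (<⇒≤)
open import Data.Product.Base using (Σ; _×_; _,_; proj₁; proj₂; ∃-syntax)
open import Data.Sum.Base using (_⊎_; inj₁; inj₂)
open import Data.Vec.Base using (count; tabulate)
open import Data.Vec.Functional using (Vector; _∷_; insertAt; replicate)
open import Data.Vec.Functional.Properties using (insertAt-lookup; insertAt-punchIn)
open import Function.Base using (_∘_; id)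
open import Level using (0ℓ)
open import Relation.Binary.PropositionalEquality as ≡ using (_≡_; cong; subst)
open import Relation.Nullary.Decidable using (Dec; does; yes; no; dec-true; dec-false; _×-dec_; _⊎-dec_)
open import Relation.Nullary.Negation using (¬_; contradiction)

-- Parity

double : ℕ → ℕ
double zero    = zero
double (suc i) = suc (suc (double i))

double≡+ : ∀ i → double i ≡ i ℕ.+ i
double≡+ zero    = ≡.refl
double≡+ (suc i) = cong suc (≡.trans (cong suc (double≡+ i)) (≡.sym (ℕ.+-suc i i)))

parity : ∀ k → ∃[ i ] (k ≡ double i ⊎ k ≡ suc (double i))
parity zero    = 0 , inj₁ ≡.refl
parity (suc k) with parity k
... | i , inj₁ ≡.refl = i , inj₂ ≡.refl
... | i , inj₂ ≡.refl = suc i , inj₁ ≡.refl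

-- Polynomials in one element of a commutative ring

-- The elements of a commutative ring R that are integer polynomials in a fixed
-- element t.  The homomorphism from the integers only serves to normalise ring
-- expressions.
module Polynomials (R : CommutativeRing 0ℓ 0ℓ)
                   (ℤ⟶R : +-*-rawRing -Raw-AlmostCommutative⟶ fromCommutativeRing R)
                   (t : CommutativeRing.Carrier R) where

  open CommutativeRing R hiding (zero)
  open Algebra.Properties.Ring ring using (-0#≈0#; -‿distribʳ-*)
  open Algebra.Properties.Semiring.Exp semiring using (_^_; ^-homo-*)
  open import Relation.Binary.Reasoning.Setoid setoid

  private
    coefficient≟ : ∀ i j → Maybe (_-Raw-AlmostCommutative⟶_.⟦_⟧ ℤ⟶R i ≈ _-Raw-AlmostCommutative⟶_.⟦_⟧ ℤ⟶R j)
    coefficient≟ i j with i ℤ.≟ j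
    ... | yes ≡.refl = just refl
    ... | no  _      = nothing

  open Algebra.Solver.Ring +-*-rawRing (fromCommutativeRing R) ℤ⟶R coefficient≟
    using (solve; _:=_; _:+_; _:*_; _:-_; :-_)

  -- Additive subgroups of R, closed under the equality of R.
  record IsSubgroup (P : Carrier → Set) : Set where
    field
      resp  : ∀ {f g} → f ≈ g → P f → P g
      zero∈ : P 0#
      add∈  : ∀ {f g} → P f → P g → P (f + g)
      neg∈  : ∀ {f} → P f → P (- f)

    sub∈ : ∀ {f g} → P f → P g → P (f - g)
    sub∈ p q = add∈ p (neg∈ q)

  -- The additive subgroup generated by a family.
  data Span {I : Set} (gen : I → Carrier) : Carrier → Set where
    generator : ∀ i → Span gen (gen i)
    span-resp : ∀ {f g} → f ≈ g → Span gen f → Span gen g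
    span-zero : Span gen 0#
    span-add  : ∀ {f g} → Span gen f → Span gen g → Span gen (f + g)
    span-neg  : ∀ {f} → Span gen f → Span gen (- f)

  span-isSubgroup : ∀ {I} (gen : I → Carrier) → IsSubgroup (Span gen)
  span-isSubgroup gen = record { resp = span-resp ; zero∈ = span-zero ; add∈ = span-add ; neg∈ = span-neg }

  span⊆ : ∀ {I} {gen : I → Carrier} {P} → IsSubgroup P → (∀ i → P (gen i)) → ∀ {f} → Span gen f → P f
  span⊆ {gen = gen} {P} P-sub gen∈ = go
    where
    open IsSubgroup P-sub
    go : ∀ {f} → Span gen f → P f
    go (generator i)     = gen∈ i
    go (span-resp f≈g p) = resp f≈g (go p)
    go span-zero         = zero∈
    go (span-add p q)    = add∈ (go p) (go q)
    go (span-neg p)      = neg∈ (go p)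

  -- The elements f with c f in the subgroup P.
  pullback : ∀ {P} c → IsSubgroup P → IsSubgroup (λ f → P (c * f))
  pullback c P-sub = record
    { resp  = λ f≈g → resp (*-congˡ f≈g)
    ; zero∈ = resp (sym (zeroʳ c)) zero∈
    ; add∈  = λ p q → resp (sym (distribˡ c _ _)) (add∈ p q)
    ; neg∈  = λ p → resp (-‿distribʳ-* c _) (neg∈ p)
    }
    where open IsSubgroup P-sub

  -- Deg d holds of the values at t of integer polynomials of degree less than d.
  -- It is a property of ring elements, not of polynomials: the same element may
  -- also be the value of a polynomial of higher degree.
  Deg : ℕ → Carrier → Set
  Deg d = Span {∃[ i ] i < d} λ (i , _) → t ^ i

  deg-≡ : ∀ {d e f} → d ≡ e → Deg d f → Deg e f
  deg-≡ ≡.refl f∈ = f∈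

  deg-mono : ∀ {d e f} → d ≤ e → Deg d f → Deg e f
  deg-mono {e = e} d≤e = span⊆ (span-isSubgroup _) λ (i , i<d) → generator (i , ℕ.<-≤-trans i<d d≤e)

  deg-zero : ∀ {f} → Deg 0 f → f ≈ 0#
  deg-zero = span⊆ (record
    { resp = λ f≈g f≈0 → trans (sym f≈g) f≈0 ; zero∈ = refl
    ; add∈ = λ p q → trans (+-cong p q) (+-identityˡ 0#) ; neg∈ = λ p → trans (-‿cong p) -0#≈0# }) λ ()

  deg-t^ : ∀ i {d f} → Deg d f → Deg (i ℕ.+ d) (t ^ i * f)
  deg-t^ i = span⊆ (pullback (t ^ i) (span-isSubgroup _)) λ (j , j<d) →
    span-resp (^-homo-* t i j) (generator (i ℕ.+ j , ℕ.+-monoʳ-< i j<d))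

  deg-t : ∀ {d f} → Deg d f → Deg (suc d) (t * f)
  deg-t p = span-resp (*-congʳ (*-identityʳ t)) (deg-t^ 1 p)

  deg-* : ∀ {a b f g} → Deg (suc a) f → Deg b g → Deg (a ℕ.+ b) (f * g)
  deg-* {a} {b} {f} {g} p q = span-resp (*-comm g f) (span⊆ (pullback g (span-isSubgroup _))
    (λ (i , i<) → span-resp (*-comm _ _) (deg-mono (ℕ.+-monoˡ-≤ b (ℕ.s≤s⁻¹ i<)) (deg-t^ i q))) p)

  deg-1 : Deg 1 1#
  deg-1 = generator (0 , s≤s z≤n)

  -- The values at t of monic integer polynomials of degree d.
  Monic : ℕ → Carrier → Set
  Monic d f = ∃[ r ] Deg d r × f ≈ t ^ d + r

  monic-resp : ∀ {d f g} → f ≈ g → Monic d f → Monic d g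
  monic-resp f≈g (r , r∈ , eq) = r , r∈ , trans (sym f≈g) eq

  monic⇒deg : ∀ {d f} → Monic d f → Deg (suc d) f
  monic⇒deg (r , r∈ , eq) = span-resp (sym eq) (span-add (generator (_ , ℕ.≤-refl)) (deg-mono (ℕ.n≤1+n _) r∈))

  monic-1 : Monic 0 1#
  monic-1 = 0# , span-zero , sym (+-identityʳ 1#)

  monic-t : ∀ {d f} → Monic d f → Monic (suc d) (t * f)
  monic-t (r , r∈ , eq) = t * r , deg-t r∈ , trans (*-congˡ eq) (distribˡ t _ _)

  monic-+ : ∀ {d f g} → Monic d f → Deg d g → Monic d (f + g)
  monic-+ {g = g} (r , r∈ , eq) g∈ = r + g , span-add r∈ g∈ , trans (+-congʳ eq) (+-assoc _ r g)

  monic-- : ∀ {d f g} → Monic d f → Deg d g → Monic d (f - g)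
  monic-- p q = monic-+ p (span-neg q)

  -- The elements σ q + τ r with q of degree less than a and r of degree less than b.
  Comb : Carrier → Carrier → ℕ → ℕ → Carrier → Set
  Comb σ τ a b f = ∃[ q ] ∃[ r ] Deg a q × Deg b r × f ≈ σ * q + τ * r

  comb-isSubgroup : ∀ σ τ a b → IsSubgroup (Comb σ τ a b)
  comb-isSubgroup σ τ a b = record
    { resp  = λ { f≈g (q , r , q∈ , r∈ , eq) → q , r , q∈ , r∈ , trans (sym f≈g) eq }
    ; zero∈ = 0# , 0# , span-zero , span-zero , sym (trans (+-cong (zeroʳ σ) (zeroʳ τ)) (+-identityˡ 0#))
    ; add∈  = λ { (q , r , q∈ , r∈ , eq) (q′ , r′ , q′∈ , r′∈ , eq′) →
        q + q′ , r + r′ , span-add q∈ q′∈ , span-add r∈ r′∈ ,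
        trans (+-cong eq eq′)
            (solve 6 (λ σ τ q r q′ r′ → σ :* q :+ τ :* r :+ (σ :* q′ :+ τ :* r′) := σ :* (q :+ q′) :+ τ :*
            (r :+ r′)) refl σ τ q r q′ r′) }
    ; neg∈  = λ { (q , r , q∈ , r∈ , eq) → - q , - r , span-neg q∈ , span-neg r∈ ,
        trans (-‿cong eq) (solve 4 (λ σ τ q r → :- (σ :* q :+ τ :* r) := σ :* (:- q) :+ τ :* (:- r)) refl σ τ q r) }
    }

  -- The elements k q + r with q of degree less than s and r of degree less than e.
  Quotient : Carrier → ℕ → ℕ → Carrier → Set
  Quotient k s e f = ∃[ q ] ∃[ r ] Deg s q × Deg e r × f ≈ k * q + r

  abstract

    -- Division with remainder by a monic polynomial k of degree e.
    division : ∀ {e k} s → Monic e k → ∀ {f} → Deg (e ℕ.+ s) f → Quotient k s e f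
    division {e} {k} zero monic {f} f∈ = 0# , f , span-zero , deg-≡ (ℕ.+-identityʳ e) f∈ ,
      sym (trans (+-congʳ (zeroʳ k)) (+-identityˡ f))
    division {e} {k} (suc s) monic@(ρ , ρ∈ , k≈) f∈ = clean
        (span⊆ (comb-isSubgroup k 1# (suc s) e) monomial f∈)
      where
      clean : ∀ {f} → Comb k 1# (suc s) e f → Quotient k (suc s) e f
      clean (q , r , q∈ , r∈ , eq) = q , r , q∈ , r∈ , trans eq (+-congˡ (*-identityˡ r))
      monomial : ((i , _) : ∃[ i ] i < e ℕ.+ suc s) → Comb k 1# (suc s) e (t ^ i)
      monomial (i , i<) with ℕ.m≤n⇒m<n∨m≡n (ℕ.s≤s⁻¹ (subst (i <_) (ℕ.+-suc e s) i<))
      ... | inj₁ i<e+s with division s monic (generator (i , i<e+s))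
      ...   | q , r , q∈ , r∈ , eq = q , r , deg-mono (ℕ.n≤1+n s) q∈ , r∈ , trans eq
          (+-congˡ (sym (*-identityˡ r)))
      monomial (i , i<) | inj₂ ≡.refl with division s monic (deg-≡ (ℕ.+-comm s e) (deg-t^ s ρ∈))
      ...   | q , r , q∈ , r∈ , eq = t ^ s - q , - r , span-add (generator (s , ℕ.≤-refl))
          (span-neg (deg-mono (ℕ.n≤1+n s) q∈)) , span-neg r∈ ,
        (begin
          t ^ (e ℕ.+ s)                            ≈⟨ ^-homo-* t e s ⟩
          t ^ e * t ^ s                            ≈⟨ solve 3 (λ a b ρ → a :* b := (a :+ ρ) :* b :- b :* ρ) refl (t ^ e) (t ^ s) ρ ⟩
          (t ^ e + ρ) * t ^ s - t ^ s * ρ          ≈⟨ +-cong (*-congʳ (sym k≈)) (-‿cong eq) ⟩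
          k * t ^ s - (k * q + r)                  ≈⟨ solve 4 (λ k s q r → k :* s :- (k :* q :+ r) := k :* (s :- q) :+ (:- r)) refl k (t ^ s) q r ⟩
          k * (t ^ s - q) - r                      ≈⟨ +-congˡ (*-identityˡ (- r)) ⟨
          k * (t ^ s - q) + 1# * (- r)             ∎)

  -- The polynomials of the path

  -- ψ l is the characteristic polynomial at t of the last l rows and columns of
  -- the signless Laplacian of a path with more than l vertices; its diagonal is
  -- 2, ..., 2, 1 there.
  ψ : ℕ → Carrier
  ψ zero          = 1#
  ψ (suc zero)    = t - 1#
  ψ (suc (suc k)) = t * ψ (suc k) - (ψ (suc k) + ψ (suc k)) - ψ k

  -- φ k is the characteristic polynomial at t of the signless Laplacian of the
  -- path on k + 2 vertices, which has the diagonal entry 1 at both ends.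
  φ : ℕ → Carrier
  φ k = t * ψ (suc k) - ψ (suc k) - ψ k

  monic-ψ : ∀ k → Monic k (ψ k)
  monic-ψ zero          = monic-1
  monic-ψ (suc zero)    = monic-resp (+-congʳ (*-identityʳ t)) (monic-- (monic-t monic-1) deg-1)
  monic-ψ (suc (suc k)) = monic--
      (monic-- (monic-t (monic-ψ (suc k)))
      (span-add (monic⇒deg (monic-ψ (suc k))) (monic⇒deg (monic-ψ (suc k)))))
                                  (deg-mono (ℕ.n≤1+n _) (monic⇒deg (monic-ψ k)))

  monic-φ : ∀ k → Monic (suc (suc k)) (φ k)
  monic-φ k = monic-- (monic-- (monic-t (monic-ψ (suc k))) (monic⇒deg (monic-ψ (suc k))))
      (deg-mono (ℕ.n≤1+n _) (monic⇒deg (monic-ψ k)))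

  abstract

    -- One step of the Euclidean algorithm, read backwards: if τ is expressed through
    -- ρ and σ, combinations of σ and τ become combinations of ρ and σ.
    bézout-step : ∀ {k ρ σ τ c} → Monic (suc k) σ → Deg 1 c → ρ ≈ t * σ - c * σ - τ →
                  (∀ {f} → Deg (suc k) f → Comb σ τ k (suc k) f) →
                  ∀ {f} → Deg (suc (suc k)) f → Comb ρ σ (suc k) (suc (suc k)) f
    bézout-step {k} {ρ} {σ} {τ} {c} monic c∈ ρ≈ comb {f} f∈
      with q₀ , f₀ , q₀∈ , f₀∈ , eq₀ ← division 1 monic (deg-≡ (ℕ.+-comm 1 (suc k)) f∈)
      with q , r , q∈ , r∈ , eq ← comb f₀∈
      = - r , q₀ + q + (t * r - c * r) , span-neg r∈ ,
        span-add (span-add (deg-mono (s≤s z≤n) q₀∈) (deg-mono (ℕ.m≤n+m k 2) q∈))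
            (span-add (deg-t r∈) (span-neg (deg-mono (ℕ.n≤1+n _) (deg-* c∈ r∈)))) ,
        (begin
          f                                   ≈⟨ trans eq₀ (+-congˡ eq) ⟩
          σ * q₀ + (σ * q + τ * r)            ≈⟨ solve 7 (λ t σ τ c q₀ q r → σ :* q₀ :+ (σ :* q :+ τ :* r)
                                                   := (t :* σ :- c :* σ :- τ) :* (:- r) :+ σ :* (q₀ :+ q :+ (t :* r :- c :* r))) refl t σ τ c q₀ q r ⟩
          (t * σ - c * σ - τ) * (- r) + σ * (q₀ + q + (t * r - c * r)) ≈⟨ +-congʳ (*-congʳ ρ≈) ⟨
          ρ * (- r) + σ * (q₀ + q + (t * r - c * r)) ∎)

    bézout-ψ : ∀ k {f} → Deg (suc k) f → Comb (ψ (suc k)) (ψ k) k (suc k) f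
    bézout-ψ zero    {f} f∈ = 0# , f , span-zero , f∈ , sym
        (trans (+-cong (zeroʳ _) (*-identityˡ f)) (+-identityˡ f))
    bézout-ψ (suc k) = bézout-step (monic-ψ (suc k)) (span-add deg-1 deg-1)
      (+-congʳ (+-congˡ (-‿cong (sym (trans (distribʳ _ 1# 1#) (+-cong (*-identityˡ _) (*-identityˡ _)))))))
          (bézout-ψ k)

    bézout-φ : ∀ k {f} → Deg (suc (suc k)) f → Comb (φ k) (ψ (suc k)) (suc k) (suc (suc k)) f
    bézout-φ k = bézout-step (monic-ψ (suc k)) deg-1 (+-congʳ (+-congˡ (-‿cong (sym (*-identityˡ _)))))
        (bézout-ψ k)

  -- The polynomials ψ 0, ..., ψ (s - 1) generate all polynomials of degree less than s.
  ψ-spans : ∀ {P} → IsSubgroup P → ∀ s → (∀ i → i < s → P (ψ i)) → ∀ {f} → Deg s f → P f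
  ψ-spans {P} P-sub zero    ψ∈ f∈ = resp (sym (deg-zero f∈)) zero∈
    where open IsSubgroup P-sub
  ψ-spans {P} P-sub (suc s) ψ∈ f∈ = span⊆ P-sub monomial f∈
    where
    open IsSubgroup P-sub
    low : ∀ {f} → Deg s f → P f
    low = ψ-spans P-sub s λ i i<s → ψ∈ i (ℕ.m<n⇒m<1+n i<s)
    monomial : ((i , _) : ∃[ i ] i < suc s) → P (t ^ i)
    monomial (i , i<) with ℕ.m≤n⇒m<n∨m≡n (ℕ.s≤s⁻¹ i<)
    ... | inj₁ i<s = low (generator (i , i<s))
    ... | inj₂ ≡.refl with r , r∈ , eq ← monic-ψ s =
      resp (trans (+-congʳ eq) (solve 2 (λ a r → a :+ r :- r := a) refl (t ^ s) r)) (sub∈ (ψ∈ s ℕ.≤-refl) (low r∈))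

  -- With t = z², and S_j the polynomials in z given by S_0 = 1, S_1 = z and
  -- S_{j+1} = z S_j - S_{j-1}, these are α i = S_{2i} and β i = S_{2i-1} / z.
  -- The identities below are those for ψ j = S_j² - S_{j-1}² and for
  -- ψ 0 + ... + ψ j = S_j², split according to the parity of j.
  α β : ℕ → Carrier
  α zero    = 1#
  α (suc i) = t * β (suc i) - α i
  β zero    = 0#
  β (suc i) = α i - β i

  ψ-double     : ∀ i → ψ (double i) ≈ α i * α i - t * (β i * β i)
  ψ-suc-double : ∀ i → ψ (suc (double i)) ≈ t * (β (suc i) * β (suc i)) - α i * α i

  ψ-double zero    = sym
      (trans (+-cong (*-identityˡ 1#) (trans (-‿cong (trans (*-congˡ (zeroˡ 0#)) (zeroʳ t))) -0#≈0#))
      (+-identityʳ 1#))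
  ψ-double (suc i) = trans
    (+-cong (+-cong (*-congˡ (ψ-suc-double i)) (-‿cong (+-cong (ψ-suc-double i) (ψ-suc-double i))))
        (-‿cong (ψ-double i)))
    (solve 3 (λ t a b → let b′ = a :- b ; a′ = t :* b′ :- a ; o = t :* (b′ :* b′) :- a :* a in
      t :* o :- (o :+ o) :- (a :* a :- t :* (b :* b)) := a′ :* a′ :- t :* (b′ :* b′)) refl t (α i) (β i))
  ψ-suc-double zero = +-cong
      (sym (trans (*-congˡ (trans (*-cong 1-0 1-0) (*-identityˡ 1#))) (*-identityʳ t)))
      (-‿cong (sym (*-identityˡ 1#)))
    where
    1-0 : 1# - 0# ≈ 1#
    1-0 = trans (+-congˡ -0#≈0#) (+-identityʳ 1#)
  ψ-suc-double (suc i) = trans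
    (+-cong (+-cong (*-congˡ (ψ-double (suc i))) (-‿cong (+-cong (ψ-double (suc i)) (ψ-double (suc i)))))
        (-‿cong (ψ-suc-double i)))
    (solve 3 (λ t a b → let b′ = a :- b ; a′ = t :* b′ :- a ; b″ = a′ :- b′ ; e = a′ :* a′ :- t :* (b′ :* b′) in
      t :* e :- (e :+ e) :- (t :* (b′ :* b′) :- a :* a) := t :* (b″ :* b″) :- a′ :* a′) refl t (α i) (β i))

  -- Σψ s is ψ 0 + ... + ψ (s - 1).
  Σψ : ℕ → Carrier
  Σψ zero    = 0#
  Σψ (suc k) = Σψ k + ψ k

  Σψ-double     : ∀ i → Σψ (double i) ≈ t * (β i * β i)
  Σψ-suc-double : ∀ i → Σψ (suc (double i)) ≈ α i * α i
  Σψ-double zero    = sym (trans (*-congˡ (zeroˡ 0#)) (zeroʳ t))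
  Σψ-double (suc i) = trans (+-cong (Σψ-suc-double i) (ψ-suc-double i)) (solve 2 (λ p q → p :+ (q :- p) := q) refl (α i * α i) (t * (β (suc i) * β (suc i))))
  Σψ-suc-double i = trans (+-cong (Σψ-double i) (ψ-double i)) (solve 2 (λ p q → p :+ (q :- p) := q) refl (t * (β i * β i)) (α i * α i))

  φ-double : ∀ i → φ (double i) ≈ β (suc i) * (t * (t * β (suc i) - (α i + α i)))
  φ-double i = trans
      (+-cong (+-cong (*-congˡ (ψ-suc-double i)) (-‿cong (ψ-suc-double i))) (-‿cong (ψ-double i)))
    (solve 3 (λ t a b → let b′ = a :- b ; o = t :* (b′ :* b′) :- a :* a in
      t :* o :- o :- (a :* a :- t :* (b :* b)) := b′ :* (t :* (t :* b′ :- (a :+ a)))) refl t (α i) (β i))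

  φ-suc-double : ∀ i → φ (suc (double i)) ≈ α (suc i) * (t * (α (suc i) - (β (suc i) + β (suc i))))
  φ-suc-double i = trans
      (+-cong (+-cong (*-congˡ (ψ-double (suc i))) (-‿cong (ψ-double (suc i)))) (-‿cong (ψ-suc-double i)))
    (solve 3 (λ t a b → let b′ = a :- b ; a′ = t :* b′ :- a ; e = a′ :* a′ :- t :* (b′ :* b′) in
      t :* e :- e :- (t :* (b′ :* b′) :- a :* a) := a′ :* (t :* (a′ :- (b′ :+ b′)))) refl t (α i) (β i))

  monic-α : ∀ i → Monic i (α i)
  monic-β : ∀ i → Monic i (β (suc i))
  deg-β   : ∀ i → Deg i (β i)
  monic-α zero    = monic-1
  monic-α (suc i) = monic-- (monic-t (monic-β i)) (monic⇒deg (monic-α i))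
  monic-β i       = monic-- (monic-α i) (deg-β i)
  deg-β zero      = span-zero
  deg-β (suc i)   = monic⇒deg (monic-β i)

  -- Monic divisors of degree d of f, with a monic cofactor of degree m - d.
  record MonicDivisor (f : Carrier) (m d : ℕ) : Set where
    field
      divisor cofactor  : Carrier
      cofactor-degree   : ℕ
      divisor-monic     : Monic d divisor
      cofactor-monic    : Monic cofactor-degree cofactor
      divisor*cofactor  : divisor * cofactor ≈ f
      degrees           : cofactor-degree ℕ.+ d ≡ m

  open MonicDivisor

  abstract

    Σψ-factors : ∀ k → ∃[ d₁ ] ∃[ d₂ ] Σ
        (MonicDivisor (φ k) (suc (suc k)) d₁ × MonicDivisor (φ k) (suc (suc k)) d₂) λ (h₁ , h₂) →
      Σψ (suc (suc k)) ≈ divisor h₁ * divisor h₂ × d₁ ℕ.+ d₂ ≡ suc k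
    Σψ-factors k with parity k
    ... | i , inj₁ ≡.refl = i , suc i ,
      ( record { divisor = β (suc i) ; cofactor = t * (t * β (suc i) - (α i + α i)) ; cofactor-degree = suc (suc i)
               ; divisor-monic = monic-β i
               ; cofactor-monic = monic-t
                   (monic-- (monic-t (monic-β i)) (span-add (monic⇒deg (monic-α i)) (monic⇒deg (monic-α i))))
               ; divisor*cofactor = sym (φ-double i) ; degrees = cong (λ z → suc (suc z))
                   (≡.sym (double≡+ i)) }
      , record { divisor = t * β (suc i) ; cofactor = t * β (suc i) - (α i + α i) ; cofactor-degree = suc i
               ; divisor-monic = monic-t (monic-β i)
               ; cofactor-monic = monic-- (monic-t (monic-β i))
                   (span-add (monic⇒deg (monic-α i)) (monic⇒deg (monic-α i)))
               ; divisor*cofactor = trans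
                   (solve 3 (λ t b c → t :* b :* c := b :* (t :* c)) refl t (β (suc i))
                   (t * β (suc i) - (α i + α i))) (sym (φ-double i))
               ; degrees = cong suc (≡.trans (ℕ.+-suc i i) (cong suc (≡.sym (double≡+ i)))) } ) ,
      trans (Σψ-double (suc i)) (solve 2 (λ t b → t :* (b :* b) := b :* (t :* b)) refl t (β (suc i))) ,
      ≡.trans (ℕ.+-suc i i) (cong suc (≡.sym (double≡+ i)))
    ... | i , inj₂ ≡.refl = suc i , suc i , (h , h) , Σψ-suc-double (suc i) , cong suc
        (≡.trans (ℕ.+-suc i i) (cong suc (≡.sym (double≡+ i))))
      where
      h : MonicDivisor (φ (suc (double i))) (suc (suc (suc (double i)))) (suc i)
      h = record { divisor = α (suc i) ; cofactor = t * (α (suc i) - (β (suc i) + β (suc i))) ; cofactor-degree = suc (suc i)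
                 ; divisor-monic = monic-α (suc i)
                 ; cofactor-monic = monic-t
                     (monic-- (monic-α (suc i)) (span-add (deg-β (suc i)) (deg-β (suc i))))
                 ; divisor*cofactor = sym (φ-suc-double i)
                 ; degrees = cong (λ z → suc (suc z))
                     (≡.trans (ℕ.+-suc i i) (cong suc (≡.sym (double≡+ i)))) }

  private
    unit-identity : ∀ u x q r → u * (x * q + r) ≈ x * u * q + u * r
    unit-identity = solve 4 (λ u x q r → u :* (x :* q :+ r) := x :* u :* q :+ u :* r) refl

    combination-identity : ∀ φ q w q′ u r′ → φ * q + w * (φ * q′ + u * r′) ≈ φ * (q + w * q′) + u * w * r′
    combination-identity = solve 6
        (λ φ q w q′ u r′ → φ :* q :+ w :* (φ :* q′ :+ u :* r′) := φ :* (q :+ w :* q′) :+ u :* w :* r′) refl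

    box-identity : ∀ x u w g r → x * u * (w * g) + u * w * r ≈ u * w * (x * g + r)
    box-identity = solve 5 (λ x u w g r → x :* u :* (w :* g) :+ u :* w :* r := u :* w :* (x :* g :+ r)) refl

    shift-identity : ∀ x u w y f → x * u * (w * (y * f)) ≈ u * w * (x * y * f)
    shift-identity = solve 5 (λ x u w y f → x :* u :* (w :* (y :* f)) := u :* w :* (x :* y :* f)) refl

    spread-identity : ∀ x u q r f → x * (u * (q * f)) + u * (r * f) ≈ u * (x * q + r) * f
    spread-identity = solve 5
        (λ x u q r f → x :* (u :* (q :* f)) :+ u :* (r :* f) := u :* (x :* q :+ r) :* f) refl

    collect-identity : ∀ H u q r → H * (u * q) + u * r ≈ u * (H * q + r)
    collect-identity = solve 4 (λ H u q r → H :* (u :* q) :+ u :* r := u :* (H :* q :+ r)) refl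

    factor-identity : ∀ H C q r → H * C * q + H * r ≈ H * (C * q + r)
    factor-identity = solve 4 (λ H C q r → H :* C :* q :+ H :* r := H :* (C :* q :+ r)) refl

  -- The relation between φ and x

  -- Consequences of the relation φ = x u, where x is a further element of R and
  -- u = ψ (m - 1), m = k + 2.
  module Relation (k : ℕ) (x : Carrier) (φ≈xψ : φ k ≈ x * ψ (suc k)) where

    m : ℕ
    m = suc (suc k)

    u : Carrier
    u = ψ (suc k)

    u-degree : Deg m u
    u-degree = monic⇒deg (monic-ψ (suc k))

    φ-degree : Deg (suc m) (φ k)
    φ-degree = monic⇒deg (monic-φ k)

    u-unit : ∃[ q ] ∃[ r ] Deg (suc k) q × Deg m r × u * (x * q + r) ≈ 1#
    u-unit with q , r , q∈ , r∈ , eq ← bézout-φ k (deg-mono {e = m} (s≤s z≤n) deg-1) = q , r , q∈ , r∈ ,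
      (begin
        u * (x * q + r)      ≈⟨ unit-identity u x q r ⟩
        x * u * q + u * r    ≈⟨ +-congʳ (*-congʳ φ≈xψ) ⟨
        φ k * q + u * r      ≈⟨ eq ⟨
        1#                   ∎)

    deg-u^ : ∀ i {d f} → Deg d f → Deg (i ℕ.* suc k ℕ.+ d) (u ^ i * f)
    deg-u^ zero    f∈ = span-resp (sym (*-identityˡ _)) f∈
    deg-u^ (suc i) {d} f∈ = span-resp (sym (*-assoc u (u ^ i) _))
      (deg-≡ (≡.sym (ℕ.+-assoc (suc k) (i ℕ.* suc k) d)) (deg-* u-degree (deg-u^ i f∈)))

    -- Every polynomial of degree less than m (n + 1) is φ q + u^i r with r of degree
    -- less than m, for i at most n.  Passing from i to i + 1 rewrites r by the Bézout
    -- relation; the bound on i keeps the degree of q less than m n.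
    φ-u^-combination : ∀ n i → i ≤ n → ∀ {f} → Deg (m ℕ.* suc n) f → Comb (φ k) (u ^ i) (m ℕ.* n) m f
    φ-u^-combination n zero _ {f} f∈
      with q , r , q∈ , r∈ , eq ← division (m ℕ.* n) (monic-φ k) (deg-≡ (ℕ.*-suc m n) f∈)
      = q , r , q∈ , r∈ , trans eq (+-congˡ (sym (*-identityˡ r)))
    φ-u^-combination n (suc i) i<n {f} f∈
      with q , r , q∈ , r∈ , eq ← φ-u^-combination n i (ℕ.<⇒≤ i<n) f∈
      with q′ , r′ , q′∈ , r′∈ , eq′ ← bézout-φ k r∈
      = q + u ^ i * q′ , r′ , span-add q∈ (deg-mono bound (deg-u^ i q′∈)) , r′∈ ,
        (begin
          f                                          ≈⟨ trans eq (+-congˡ (*-congˡ eq′)) ⟩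
          φ k * q + u ^ i * (φ k * q′ + u * r′)      ≈⟨ combination-identity (φ k) q (u ^ i) q′ u r′ ⟩
          φ k * (q + u ^ i * q′) + u ^ suc i * r′    ∎)
      where
      bound : i ℕ.* suc k ℕ.+ suc k ≤ m ℕ.* n
      bound = ℕ.≤-trans (ℕ.≤-reflexive (ℕ.+-comm (i ℕ.* suc k) (suc k)))
              (ℕ.≤-trans (ℕ.*-mono-≤ i<n (ℕ.n≤1+n (suc k))) (ℕ.≤-reflexive (ℕ.*-comm n m)))

    -- The additive subgroup generated by x^j t^i, j < n, i < m.
    Box : ℕ → Carrier → Set
    Box n = Span {(∃[ j ] j < n) × (∃[ i ] i < m)} λ ((j , _) , (i , _)) → x ^ j * t ^ i

    box-base : ∀ {n f} → Deg m f → Box (suc n) f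
    box-base = span⊆ (span-isSubgroup _) λ i → span-resp (*-identityˡ _) (generator ((0 , s≤s z≤n) , i))

    box-x : ∀ {n f} → Box n f → Box (suc n) (x * f)
    box-x = span⊆ (pullback x (span-isSubgroup _)) λ ((j , j<n) , i) →
      span-resp (*-assoc x (x ^ j) _) (generator ((suc j , s≤s j<n) , i))

    -- Polynomials in t of degree less than m (n + 1) are u^n times integer
    -- combinations of x^j t^i, j at most n, i < m.
    deg⇒u^*box : ∀ n {f} → Deg (m ℕ.* suc n) f → ∃[ g ] Box (suc n) g × f ≈ u ^ n * g
    deg⇒u^*box n {f} f∈ with q , r , q∈ , r∈ , eq ← φ-u^-combination n n ℕ.≤-refl f∈ = go n q∈ eq
      where
      go : ∀ n {q} → Deg (m ℕ.* n) q → f ≈ φ k * q + u ^ n * r → ∃[ g ] Box (suc n) g × f ≈ u ^ n * g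
      go zero {q} q∈ eq = r , box-base r∈ ,
        trans eq (trans (+-congʳ (trans (*-congˡ (deg-zero (deg-≡ (ℕ.*-zeroʳ m) q∈))) (zeroʳ (φ k))))
            (+-identityˡ _))
      go (suc n) {q} q∈ eq with g , g∈ , eq′ ← deg⇒u^*box n q∈ = x * g + r , span-add (box-x g∈)
          (box-base r∈) ,
        (begin
          f                                       ≈⟨ trans eq (+-congʳ (*-cong φ≈xψ eq′)) ⟩
          x * u * (u ^ n * g) + u ^ suc n * r     ≈⟨ box-identity x u (u ^ n) g r ⟩
          u ^ suc n * (x * g + r)                 ∎)

    -- The converse: each factor x of x^j absorbs a factor u and becomes φ.
    u^*box⇒deg : ∀ n j → j ≤ n → ∀ {f} → Deg m f → Deg (m ℕ.* suc n) (u ^ n * (x ^ j * f))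
    u^*box⇒deg n zero _ {f} f∈ = span-resp (*-congˡ (sym (*-identityˡ f)))
      (deg-mono (ℕ.≤-trans (ℕ.≤-reflexive (ℕ.+-comm (n ℕ.* suc k) m))
          (ℕ.≤-trans (ℕ.+-monoʳ-≤ m (ℕ.*-monoʳ-≤ n (ℕ.n≤1+n (suc k)))) (ℕ.≤-reflexive (ℕ.*-comm (suc n) m))))
        (deg-u^ n f∈))
    u^*box⇒deg (suc n) (suc j) (s≤s j≤n) {f} f∈ = span-resp
      (begin
        φ k * (u ^ n * (x ^ j * f))       ≈⟨ *-congʳ φ≈xψ ⟩
        x * u * (u ^ n * (x ^ j * f))     ≈⟨ shift-identity x u (u ^ n) (x ^ j) f ⟩
        u ^ suc n * (x ^ suc j * f)       ∎)
      (deg-≡ (≡.sym (ℕ.*-suc m (suc n))) (deg-* φ-degree (u^*box⇒deg n j j≤n f∈)))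

    module _ {P : Carrier → Set} (P-sub : IsSubgroup P) (x-stable : ∀ {f} → P f → P (x * f))
             {d} (h : MonicDivisor (φ k) m d) where
      open IsSubgroup P-sub
      private
        e = cofactor-degree h
        H = divisor h
        C = cofactor h

      -- An additive subgroup stable under x that contains h t^i, i < e, and u t^j,
      -- j < d, contains every polynomial in t; here h c = φ, and e and d are the
      -- degrees of c and h.  As u is a unit, multiples of u suffice.
      generates-everything : (∀ i → i < e → P (H * t ^ i)) → (∀ j → j < d → P (u * t ^ j)) → ∀ {s f} →
          Deg s f → P f
      generates-everything Ht ut {f = f} f∈ with q , r , q∈ , r∈ , eq ← u-unit = resp
        (begin
          x * (u * (q * f)) + u * (r * f)        ≈⟨ spread-identity x u q r f ⟩
          u * (x * q + r) * f                    ≈⟨ *-congʳ eq ⟩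
          1# * f                                 ≈⟨ *-identityˡ f ⟩
          f                                      ∎)
        (add∈ (x-stable (u-all _ (deg-mono (ℕ.m≤n+m _ d) (deg-* q∈ f∈))))
            (u-all _ (deg-mono (ℕ.m≤n+m _ d) (deg-* r∈ f∈))))
        where
        H-low : ∀ {f} → Deg e f → P (H * f)
        H-low = span⊆ (pullback H P-sub) λ (i , i<e) → Ht i i<e
        u-low : ∀ {f} → Deg d f → P (u * f)
        u-low = span⊆ (pullback u P-sub) λ (i , i<d) → ut i i<d
        degree-uq : ∀ s → suc k ℕ.+ suc s ≡ e ℕ.+ (d ℕ.+ s)
        degree-uq s = ≡.trans (ℕ.+-suc (suc k) s)
            (≡.trans (cong (ℕ._+ s) (≡.sym (degrees h))) (ℕ.+-assoc e d s))
        -- Division of f by h and then of u q by c lowers the degree by one: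
        -- u f = h (u q) + u r and h (u q) = φ q′ + h r′ = x (u q′) + h r′.
        u-all : ∀ s {f} → Deg (d ℕ.+ s) f → P (u * f)
        u-all zero {f} f∈ = u-low (deg-≡ (ℕ.+-identityʳ d) f∈)
        u-all (suc s) {f} f∈
          with q , r , q∈ , r∈ , eq ← division (suc s) (divisor-monic h) f∈
          with q′ , r′ , q′∈ , r′∈ , eq′ ← division (d ℕ.+ s) (cofactor-monic h)
              (deg-≡ (degree-uq s) (deg-* u-degree q∈))
          = resp
            (begin
              x * (u * q′) + H * r′ + u * r     ≈⟨ +-congʳ (+-congʳ (*-assoc x u q′)) ⟨
              x * u * q′ + H * r′ + u * r
                ≈⟨ +-congʳ (+-congʳ (*-congʳ (trans (divisor*cofactor h) φ≈xψ))) ⟨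
              H * C * q′ + H * r′ + u * r
                ≈⟨ +-congʳ (trans (+-congʳ (*-assoc H C q′)) (sym (distribˡ H _ _))) ⟩
              H * (C * q′ + r′) + u * r         ≈⟨ +-congʳ (*-congˡ eq′) ⟨
              H * (u * q) + u * r               ≈⟨ collect-identity H u q r ⟩
              u * (H * q + r)                   ≈⟨ *-congˡ eq ⟨
              u * f                             ∎)
            (add∈ (add∈ (x-stable (u-all s q′∈)) (H-low r′∈)) (u-low r∈))

    cofactor-degree≤ : ∀ {d j f} (h : MonicDivisor (φ k) m d) → j < d → Deg (suc j) f → Deg m (cofactor h * f)
    cofactor-degree≤ {d} {j} h j<d f∈ =
      deg-mono (ℕ.≤-trans (ℕ.+-monoʳ-≤ (cofactor-degree h) j<d) (ℕ.≤-reflexive (degrees h)))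
          (deg-* (monic⇒deg (cofactor-monic h)) f∈)

    -- Let h c = φ, and let e and d be the degrees of c and h.  An additive subgroup
    -- that contains h t^i, i < e, and x u t^j = φ t^j, j < d, contains all h f with
    -- f of degree less than m.
    divisor-multiples : ∀ {P : Carrier → Set} → IsSubgroup P → ∀ {d} (h : MonicDivisor (φ k) m d) →
      (∀ i → i < cofactor-degree h → P (divisor h * t ^ i)) → (∀ j → j < d → P (x * (u * t ^ j))) →
      ∀ {f} → Deg m f → P (divisor h * f)
    divisor-multiples P-sub {d} h Ht xut {f} f∈
      with q , r , q∈ , r∈ , eq ← division d (cofactor-monic h) (deg-≡ (≡.sym (degrees h)) f∈) = resp
      (begin
        x * (u * q) + H * r
          ≈⟨ +-congʳ (trans (sym (*-assoc x u q)) (*-congʳ (trans (sym φ≈xψ) (sym (divisor*cofactor h))))) ⟩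
        H * C * q + H * r     ≈⟨ factor-identity H C q r ⟩
        H * (C * q + r)       ≈⟨ *-congˡ eq ⟨
        H * f                 ∎)
      (add∈ (span⊆ (pullback u (pullback x P-sub)) (λ (j , j<d) → xut j j<d) q∈)
          (span⊆ (pullback H P-sub) (λ (i , i<e) → Ht i i<e) r∈))
      where
      open IsSubgroup P-sub
      H = divisor h
      C = cofactor h

open import Data.Integer.Base using (_+_; -_; _*_; _^_)
open ≡ using (_≢_; _≗_; refl; sym; trans; cong₂; cong-app; module ≡-Reasoning)
open import Algebra.Properties.CommutativeMonoid.Sum ℤ.+-0-commutativeMonoid
  using (sum; sum-cong-≗; sum-replicate-zero; sum-remove; ∑-distrib-+; ∑-comm)
open ≡-Reasoning

-- Sums and matrices

*-distribˡ-sum : ∀ {n} x (f : Vector ℤ n) → x * sum f ≡ sum (λ k → x * f k)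
*-distribˡ-sum = Algebra.Properties.Semiring.Sum.*-distribˡ-sum ℤ.+-*-semiring

*-distribʳ-sum : ∀ {n} x (f : Vector ℤ n) → sum f * x ≡ sum (λ k → f k * x)
*-distribʳ-sum = Algebra.Properties.Semiring.Sum.*-distribʳ-sum ℤ.+-*-semiring

sum-zero : ∀ {n} {f : Vector ℤ n} → (∀ k → f k ≡ 0ℤ) → sum f ≡ 0ℤ
sum-zero {n} f≡0 = trans (sum-cong-≗ f≡0) (sum-replicate-zero n)

sum-single : ∀ {n} (j : Fin n) {f : Vector ℤ n} → (∀ k → k ≢ j → f k ≡ 0ℤ) → sum f ≡ f j
sum-single {suc n} j {f} f≡0 = begin
  sum f                              ≡⟨ sum-remove {i = j} f ⟩
  f j + sum (λ k → f (punchIn j k))  ≡⟨ cong (f j +_) (sum-zero λ k → f≡0 _ (punchInᵢ≢i j k)) ⟩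
  f j + 0ℤ                           ≡⟨ ℤ.+-identityʳ _ ⟩
  f j                                ∎

sum-linear : ∀ {n} s (f g : Vector ℤ n) → sum (λ k → s * f k + g k) ≡ s * sum f + sum g
sum-linear s f g = trans (∑-distrib-+ (λ k → s * f k) g) (cong (_+ sum g) (sym (*-distribˡ-sum s f)))

-- The identity matrix.
identity : ∀ {n} → Matrix n n
identity i j = if does (i ≟ j) then 1ℤ else 0ℤ

identity-diag : ∀ {n} (i : Fin n) → identity i i ≡ 1ℤ
identity-diag i rewrite dec-true (i ≟ i) refl = refl

identity-off : ∀ {n} {i j : Fin n} → i ≢ j → identity i j ≡ 0ℤ
identity-off {i = i} {j} i≢j rewrite dec-false (i ≟ j) i≢j = refl

identity-sym : ∀ {n} (i j : Fin n) → identity i j ≡ identity j i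
identity-sym i j with i ≟ j
... | yes refl = sym (identity-diag i)
... | no  i≢j  = sym (identity-off (i≢j ∘ sym))

identity-· : ∀ {n} (v : Vector ℤ n) → identity · v ≗ v
identity-· v i = trans
    (sum-single i λ k k≢i → trans (cong (_* v k) (identity-off (k≢i ∘ sym))) (ℤ.*-zeroˡ (v k)))
                       (trans (cong (_* v i) (identity-diag i)) (ℤ.*-identityˡ (v i)))

-- The matrix product.
infixr 7 _∙_
_∙_ : ∀ {m n p} → Matrix m n → Matrix n p → Matrix m p
(A ∙ B) i k = (A · (λ j → B j k)) i

·-cong : ∀ {m n} (A : Matrix m n) {v w} → v ≗ w → A · v ≗ A · w
·-cong A v≗w i = sum-cong-≗ λ j → cong (A i j *_) (v≗w j)

·-linear : ∀ {m n} (A : Matrix m n) s v w →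
           A · (λ j → s * v j + w j) ≗ λ i → s * (A · v) i + (A · w) i
·-linear A s v w i = trans (sum-cong-≗ λ j → lem (A i j) s (v j) (w j))
    (sum-linear s (λ j → A i j * v j) (λ j → A i j * w j))
  where
  lem : ∀ a s v w → a * (s * v + w) ≡ s * (a * v) + a * w
  lem = solve-∀

·-identity : ∀ {m n} (A : Matrix m n) k → A · (λ j → identity j k) ≗ λ i → A i k
·-identity A k i = trans
    (sum-single k λ j j≢k → trans (cong (A i j *_) (identity-off j≢k)) (ℤ.*-zeroʳ (A i j)))
                         (trans (cong (A i k *_) (identity-diag k)) (ℤ.*-identityʳ (A i k)))

∙-· : ∀ {m n p} (A : Matrix m n) (B : Matrix n p) v → (A ∙ B) · v ≗ A · B · v
∙-· A B v i = begin
  sum (λ k → sum (λ j → A i j * B j k) * v k)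
    ≡⟨ sum-cong-≗
        (λ k → trans (*-distribʳ-sum (v k) (λ j → A i j * B j k))
        (sum-cong-≗ λ j → ℤ.*-assoc (A i j) (B j k) (v k))) ⟩
  sum (λ k → sum (λ j → A i j * (B j k * v k)))  ≡⟨ ∑-comm (λ k j → A i j * (B j k * v k)) ⟩
  sum (λ j → sum (λ k → A i j * (B j k * v k)))
    ≡⟨ sum-cong-≗ (λ j → sym (*-distribˡ-sum (A i j) (λ k → B j k * v k))) ⟩
  sum (λ j → A i j * (B · v) j)                  ∎

-- Multilinear alternating functions of the rows of a matrix

-- The sign of column j in the expansion along the first row.
sgn : ∀ {n} → Fin n → ℤ
sgn j = -1ℤ ^ toℕ j

-- The matrix A without the first row and column j.
minor : ∀ {n} → Matrix (suc n) (suc n) → Fin (suc n) → Matrix n n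
minor A j k l = A (suc k) (punchIn j l)

det-cong : ∀ {n} {A B : Matrix n n} → (∀ i j → A i j ≡ B i j) → det A ≡ det B
det-cong {zero}  A≡B = refl
det-cong {suc n} A≡B = sum-cong-≗ λ j →
  cong₂ _*_ (cong (sgn j *_) (A≡B zero j)) (det-cong λ k l → A≡B (suc k) (punchIn j l))

-- Functions that are linear in each row of a matrix.  The condition for row i
-- relates three matrices that agree outside that row.
record RowLinear {n} (F : Matrix n n → ℤ) : Set where
  field
    F-cong   : ∀ {A B} → (∀ i j → A i j ≡ B i j) → F A ≡ F B
    F-linear : ∀ i s {A B C} → (∀ k → k ≢ i → A k ≗ C k) → (∀ k → k ≢ i → B k ≗ C k) →
               (∀ l → C i l ≡ s * A i l + B i l) → F C ≡ s * F A + F B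

-- F vanishes on the matrices whose rows i and j are equal.
Alternating : ∀ {n} → (Matrix n n → ℤ) → Fin n → Fin n → Set
Alternating F i j = ∀ A → A i ≗ A j → F A ≡ 0ℤ

module _ {n} {F : Matrix n n → ℤ} (lin : RowLinear F) where
  open RowLinear lin

  row-zero : ∀ i {A} → (∀ l → A i l ≡ 0ℤ) → F A ≡ 0ℤ
  row-zero i {A} z = trans (F-linear i -1ℤ {A} {A} {A} (λ _ _ _ → refl) (λ _ _ _ → refl)
      λ l → trans (z l) (sym (trans (cong (λ a → -1ℤ * a + a) (z l)) refl)))
    (lem (F A))
    where
    lem : ∀ a → -1ℤ * a + a ≡ 0ℤ
    lem = solve-∀

  -- Exchanging two rows changes the sign.
  swap-rows : ∀ {i j} → i ≢ j → Alternating F i j → ∀ {A B} → B i ≗ A j → B j ≗ A i →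
              (∀ k → k ≢ i → k ≢ j → B k ≗ A k) → F B ≡ - F A
  swap-rows {i} {j} i≢j alt {A} {B} Bi Bj B-else = begin
    F B              ≡⟨ F-cong B≡ ⟩
    F (C aⱼ aᵢ)      ≡⟨ lem (F (C aᵢ aⱼ)) (F (C aⱼ aᵢ)) (trans (sym expand) (alt (C s s) C-alt)) ⟩
    - F (C aᵢ aⱼ)    ≡⟨ cong -_ (F-cong A≡) ⟩
    - F A            ∎
    where
    aᵢ = A i
    aⱼ = A j
    C : Vector ℤ n → Vector ℤ n → Matrix n n
    C p q k = if does (k ≟ i) then p else if does (k ≟ j) then q else A k
    C-i : ∀ p q → C p q i ≡ p
    C-i p q rewrite dec-true (i ≟ i) refl = refl
    C-j : ∀ p q → C p q j ≡ q
    C-j p q rewrite dec-false (j ≟ i) (i≢j ∘ sym) | dec-true (j ≟ j) refl = refl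
    C-≢i : ∀ p p′ q k → k ≢ i → C p q k ≡ C p′ q k
    C-≢i p p′ q k k≢i rewrite dec-false (k ≟ i) k≢i = refl
    C-≢j : ∀ p q q′ k → k ≢ j → C p q k ≡ C p q′ k
    C-≢j p q q′ k k≢j rewrite dec-false (k ≟ j) k≢j = refl
    s : Vector ℤ n
    s l = 1ℤ * aᵢ l + aⱼ l
    C-alt : ∀ {p} → C p p i ≗ C p p j
    C-alt {p} l = cong-app (trans (C-i p p) (sym (C-j p p))) l
    expandⱼ : ∀ p → F (C p s) ≡ 1ℤ * F (C p aᵢ) + F (C p aⱼ)
    expandⱼ p = F-linear j 1ℤ (λ k ne → cong-app (C-≢j p aᵢ s k ne)) (λ k ne → cong-app (C-≢j p aⱼ s k ne))
      λ l → trans (cong-app (C-j p s) l)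
          (cong₂ (λ x y → 1ℤ * x + y) (sym (cong-app (C-j p aᵢ) l)) (sym (cong-app (C-j p aⱼ) l)))
    expandᵢ : F (C s s) ≡ 1ℤ * F (C aᵢ s) + F (C aⱼ s)
    expandᵢ = F-linear i 1ℤ (λ k ne → cong-app (C-≢i aᵢ s s k ne)) (λ k ne → cong-app (C-≢i aⱼ s s k ne))
      λ l → trans (cong-app (C-i s s) l)
          (cong₂ (λ x y → 1ℤ * x + y) (sym (cong-app (C-i aᵢ s) l)) (sym (cong-app (C-i aⱼ s) l)))
    lem₀ : ∀ x y → 1ℤ * (1ℤ * 0ℤ + x) + (1ℤ * y + 0ℤ) ≡ x + y
    lem₀ = solve-∀
    -- Expansion of 0 = F (C s s), where both rows are the sum s of rows i and j.
    expand : F (C s s) ≡ F (C aᵢ aⱼ) + F (C aⱼ aᵢ)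
    expand = begin
      F (C s s)                        ≡⟨ expandᵢ ⟩
      1ℤ * F (C aᵢ s) + F (C aⱼ s)     ≡⟨ cong₂ (λ x y → 1ℤ * x + y) (expandⱼ aᵢ) (expandⱼ aⱼ) ⟩
      1ℤ * (1ℤ * F (C aᵢ aᵢ) + F (C aᵢ aⱼ)) + (1ℤ * F (C aⱼ aᵢ) + F (C aⱼ aⱼ))
        ≡⟨ cong₂ (λ x y → 1ℤ * (1ℤ * x + F (C aᵢ aⱼ)) + (1ℤ * F (C aⱼ aᵢ) + y)) (alt (C aᵢ aᵢ) C-alt)
            (alt (C aⱼ aⱼ) C-alt) ⟩
      1ℤ * (1ℤ * 0ℤ + F (C aᵢ aⱼ)) + (1ℤ * F (C aⱼ aᵢ) + 0ℤ) ≡⟨ lem₀ (F (C aᵢ aⱼ)) (F (C aⱼ aᵢ)) ⟩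
      F (C aᵢ aⱼ) + F (C aⱼ aᵢ)        ∎
    lem : ∀ x y → x + y ≡ 0ℤ → y ≡ - x
    lem x y e = trans (lem₁ x y) (trans (cong (_+ - x) e) (ℤ.+-identityˡ _))
      where
      lem₁ : ∀ x y → y ≡ x + y + - x
      lem₁ = solve-∀
    A≡ : ∀ k l → C aᵢ aⱼ k l ≡ A k l
    A≡ k l with k ≟ i
    ... | yes refl = refl
    ... | no _ with k ≟ j
    ... | yes refl = refl
    ... | no _ = refl
    B≡ : ∀ k l → B k l ≡ C aⱼ aᵢ k l
    B≡ k l with k ≟ i
    ... | yes refl = Bi l
    ... | no k≢i with k ≟ j
    ... | yes refl = Bj l
    ... | no k≢j = B-else k k≢i k≢j l

det-linear : ∀ {n} i s {A B C : Matrix n n} → (∀ k → k ≢ i → A k ≗ C k) → (∀ k → k ≢ i → B k ≗ C k) →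
             (∀ l → C i l ≡ s * A i l + B i l) → det C ≡ s * det A + det B
det-linear zero s {A} {B} {C} A≗C B≗C Ci = trans (sum-cong-≗ term)
    (sum-linear s (λ j → sgn j * A zero j * det (minor A j)) (λ j → sgn j * B zero j * det (minor B j)))
  where
  lem : ∀ g s a b d → g * (s * a + b) * d ≡ s * (g * a * d) + g * b * d
  lem = solve-∀
  term : ∀ j → sgn j * C zero j * det (minor C j) ≡
               s * (sgn j * A zero j * det (minor A j)) + sgn j * B zero j * det (minor B j)
  term j = begin
    sgn j * C zero j * det (minor C j) ≡⟨ cong (λ c → sgn j * c * det (minor C j)) (Ci j) ⟩
    sgn j * (s * A zero j + B zero j) * det (minor C j) ≡⟨ lem (sgn j) s (A zero j) (B zero j) _ ⟩
    s * (sgn j * A zero j * det (minor C j)) + sgn j * B zero j * det (minor C j)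
      ≡⟨ cong₂ (λ x y → s * (sgn j * A zero j * x) + sgn j * B zero j * y)
           (det-cong λ k l → sym (A≗C (suc k) (λ ()) (punchIn j l)))
           (det-cong λ k l → sym (B≗C (suc k) (λ ()) (punchIn j l))) ⟩
    _ ∎
det-linear (suc i) s {A} {B} {C} A≗C B≗C Ci = trans (sum-cong-≗ term)
    (sum-linear s (λ j → sgn j * A zero j * det (minor A j)) (λ j → sgn j * B zero j * det (minor B j)))
  where
  lem : ∀ g c s a b → g * c * (s * a + b) ≡ s * (g * c * a) + g * c * b
  lem = solve-∀
  term : ∀ j → sgn j * C zero j * det (minor C j) ≡
               s * (sgn j * A zero j * det (minor A j)) + sgn j * B zero j * det (minor B j)
  term j = begin
    sgn j * C zero j * det (minor C j) ≡⟨ cong (sgn j * C zero j *_)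
      (det-linear i s (λ k k≢i l → A≗C (suc k) (k≢i ∘ suc-injective) (punchIn j l))
                      (λ k k≢i l → B≗C (suc k) (k≢i ∘ suc-injective) (punchIn j l))
                          (λ l → Ci (punchIn j l))) ⟩
    sgn j * C zero j * (s * det (minor A j) + det (minor B j)) ≡⟨ lem (sgn j) (C zero j) s _ _ ⟩
    s * (sgn j * C zero j * det (minor A j)) + sgn j * C zero j * det (minor B j)
      ≡⟨ cong₂ (λ x y → s * (sgn j * x * det (minor A j)) + sgn j * y * det (minor B j))
           (sym (A≗C zero (λ ()) j)) (sym (B≗C zero (λ ()) j)) ⟩
    _ ∎

det-rowLinear : ∀ {n} → RowLinear (det {n})
det-rowLinear = record { F-cong = det-cong ; F-linear = det-linear }

-- A double sum over ordered pairs of distinct indices vanishes if its terms change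
-- sign when the pair is reversed.  The pair of j and punchIn j l is encoded
-- by (j , l); reversed, it is encoded by (punchIn j l , pinch l j).
ΣΣ-antisym : ∀ {n} (f : Fin (suc n) → Fin n → ℤ) →
             (∀ j l → f j l ≡ - f (punchIn j l) (pinch l j)) → sum (λ j → sum (f j)) ≡ 0ℤ
ΣΣ-antisym {zero}  f anti = refl
ΣΣ-antisym {suc n} f anti = begin
  sum (f zero) + sum (λ j → f (suc j) zero + sum (λ l → f (suc j) (suc l)))
    ≡⟨ cong (sum (f zero) +_) (∑-distrib-+ (λ j → f (suc j) zero) (λ j → sum (λ l → f (suc j) (suc l)))) ⟩
  sum (f zero) + (sum (λ j → f (suc j) zero) + sum (λ j → sum (λ l → f (suc j) (suc l))))
    ≡⟨ cong (λ z → sum (f zero) + (sum (λ j → f (suc j) zero) + z))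
        (ΣΣ-antisym (λ j l → f (suc j) (suc l)) λ j l → anti (suc j) (suc l)) ⟩
  sum (f zero) + (sum (λ j → f (suc j) zero) + 0ℤ)
    ≡⟨ cong (sum (f zero) +_) (ℤ.+-identityʳ _) ⟩
  sum (f zero) + sum (λ j → f (suc j) zero)
    ≡⟨ ∑-distrib-+ (f zero) (λ j → f (suc j) zero) ⟨
  sum (λ j → f zero j + f (suc j) zero)
    ≡⟨ sum-zero (λ j → trans (cong (_+ f (suc j) zero) (anti zero j)) (ℤ.+-inverseˡ (f (suc j) zero))) ⟩
  0ℤ ∎

sgn-swap : ∀ {n} (j : Fin (suc n)) (l : Fin n) → sgn j * sgn l ≡ - (sgn (punchIn j l) * sgn (pinch l j))
sgn-swap {suc n} zero l = lem (sgn l)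
  where
  lem : ∀ x → 1ℤ * x ≡ - (-1ℤ * x * 1ℤ)
  lem = solve-∀
sgn-swap {suc n} (suc j) zero = lem (sgn j)
  where
  lem : ∀ x → -1ℤ * x * 1ℤ ≡ - (1ℤ * x)
  lem = solve-∀
sgn-swap {suc n} (suc j) (suc l) = trans (lem (sgn j) (sgn l))
    (trans (sgn-swap j l) (cong -_ (sym (lem (sgn (punchIn j l)) (sgn (pinch l j))))))
  where
  lem : ∀ x y → -1ℤ * x * (-1ℤ * y) ≡ x * y
  lem = solve-∀

punchIn-pinch : ∀ {n} (j : Fin (suc n)) (l : Fin n) → punchIn (punchIn j l) (pinch l j) ≡ j
punchIn-pinch {suc n} zero l = refl
punchIn-pinch {suc n} (suc j) zero = refl
punchIn-pinch {suc n} (suc j) (suc l) = cong suc (punchIn-pinch j l)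

punchIn-punchIn : ∀ {n} (j : Fin (suc (suc n))) (l : Fin (suc n)) x →
                  punchIn j (punchIn l x) ≡ punchIn (punchIn j l) (punchIn (pinch l j) x)
punchIn-punchIn zero l x = refl
punchIn-punchIn (suc j) zero x = refl
punchIn-punchIn (suc j) (suc l) zero = refl
punchIn-punchIn {suc n} (suc j) (suc l) (suc x) = cong suc (punchIn-punchIn j l x)

-- Equal first two rows: in the double expansion of the determinant, the terms of
-- a pair of columns and of the reversed pair cancel.
det-alt₀₁ : ∀ {n} → Alternating (det {suc (suc n)}) zero (suc zero)
det-alt₀₁ {n} A A₀≗A₁ = trans
    (sum-cong-≗ λ j → *-distribˡ-sum (sgn j * a j) (λ l → sgn l * A (suc zero) (punchIn j l) * D j l))
    (ΣΣ-antisym _ anti)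
  where
  a = A zero
  D : Fin (suc (suc n)) → Fin (suc n) → ℤ
  D j l = det (minor (minor A j) l)
  D-swap : ∀ j l → D j l ≡ D (punchIn j l) (pinch l j)
  D-swap j l = det-cong λ k x → cong (A (suc (suc k))) (punchIn-punchIn j l x)
  lem : ∀ s a t b d → s * a * (t * b * d) ≡ (s * t) * (a * b * d)
  lem = solve-∀
  lem′ : ∀ s t a b d → (- (s * t)) * (a * b * d) ≡ - (s * b * (t * a * d))
  lem′ = solve-∀
  anti : ∀ j l → sgn j * a j * (sgn l * A (suc zero) (punchIn j l) * D j l) ≡
         - (sgn (punchIn j l) * a (punchIn j l) *
             (sgn (pinch l j) * A (suc zero) (punchIn (punchIn j l) (pinch l j)) * D (punchIn j l)
             (pinch l j)))
  anti j l = begin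
    sgn j * a j * (sgn l * A (suc zero) j′ * D j l)
      ≡⟨ cong (λ z → sgn j * a j * (sgn l * z * D j l)) (sym (A₀≗A₁ j′)) ⟩
    sgn j * a j * (sgn l * a j′ * D j l) ≡⟨ lem (sgn j) (a j) (sgn l) (a j′) (D j l) ⟩
    (sgn j * sgn l) * (a j * a j′ * D j l)
      ≡⟨ cong₂ (λ x y → x * (a j * a j′ * y)) (sgn-swap j l) (D-swap j l) ⟩
    (- (sgn j′ * sgn l′)) * (a j * a j′ * D j′ l′) ≡⟨ lem′ (sgn j′) (sgn l′) (a j) (a j′) (D j′ l′) ⟩
    - (sgn j′ * a j′ * (sgn l′ * a j * D j′ l′))
      ≡⟨ cong (λ z → - (sgn j′ * a j′ * (sgn l′ * z * D j′ l′)))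
          (trans (cong a (sym (punchIn-pinch j l))) (A₀≗A₁ _)) ⟩
    _ ∎
    where
    j′ = punchIn j l
    l′ = pinch l j

det-alt-suc : ∀ {n} {i j : Fin n} → Alternating det i j → Alternating (det {suc n}) (suc i) (suc j)
det-alt-suc alt A Aᵢ≗Aⱼ = sum-zero λ j →
  trans (cong (sgn j * A zero j *_) (alt (minor A j) (λ l → Aᵢ≗Aⱼ (punchIn j l))))
      (ℤ.*-zeroʳ (sgn j * A zero j))

det-alt₀ : ∀ {n} (j : Fin n) → Alternating (det {suc n}) zero (suc j)
det-alt : ∀ {n} (i j : Fin n) → i ≢ j → Alternating det i j

det-alt₀ {suc n} zero = det-alt₀₁
-- Exchanging rows 1 and j + 2 reduces to two equal rows on top.
det-alt₀ {suc n} (suc j) A A₀≗Aⱼ = begin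
  det A
    ≡⟨ swap-rows det-rowLinear {suc zero} {suc (suc j)}
        (λ ()) (det-alt-suc (det-alt zero (suc j) λ ())) {B} {A} (λ l → sym (B-j l)) (λ _ → refl) B-else ⟩
  - det B      ≡⟨ cong -_ (det-alt₀₁ B A₀≗Aⱼ) ⟩
  0ℤ           ∎
  where
  B : Matrix _ _
  B zero          = A zero
  B (suc zero)    = A (suc (suc j))
  B (suc (suc k)) = if does (k ≟ j) then A (suc zero) else A (suc (suc k))
  B-j : ∀ l → B (suc (suc j)) l ≡ A (suc zero) l
  B-j l rewrite dec-true (j ≟ j) refl = refl
  B-else : ∀ k → k ≢ suc zero → k ≢ suc (suc j) → A k ≗ B k
  B-else zero _ _ l = refl
  B-else (suc zero) ne _ l = contradiction refl ne
  B-else (suc (suc k)) _ ne l rewrite dec-false (k ≟ j) (λ e → ne (cong (λ z → suc (suc z)) e)) = refl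

det-alt zero    zero    i≢j = contradiction refl i≢j
det-alt zero    (suc j) i≢j = det-alt₀ j
det-alt (suc i) zero    i≢j A e = det-alt₀ i A (λ l → sym (e l))
det-alt (suc i) (suc j) i≢j = det-alt-suc (det-alt i j (i≢j ∘ cong suc))

-- The determinant as the universal alternating form

punchIn-view : ∀ {n} (j l : Fin (suc n)) → l ≡ j ⊎ ∃[ k ] l ≡ punchIn j k
punchIn-view j l with j ≟ l
... | yes j≡l = inj₁ (sym j≡l)
... | no  j≢l = inj₂ (punchOut j≢l , sym (punchIn-punchOut j≢l))

module _ {n} {F : Matrix n n → ℤ} (lin : RowLinear F) (alt : ∀ i j → i ≢ j → Alternating F i j) where
  open RowLinear lin

  -- Adding a multiple of row j to row i does not change F.
  F-addMultiple : ∀ {i j} c {A C : Matrix n n} → i ≢ j → (∀ k → k ≢ i → C k ≗ A k) →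
                  (∀ l → C i l ≡ c * A j l + A i l) → F C ≡ F A
  F-addMultiple {i} {j} c {A} {C} i≢j C-else Ci = begin
    F C             ≡⟨ F-linear i c {B} {A} (λ k k≢i l → B-else k k≢i l) (λ k k≢i l → sym (C-else k k≢i l))
                        (λ l → trans (Ci l) (cong (λ z → c * z + A i l) (sym (B-i l)))) ⟩
    c * F B + F A
      ≡⟨ cong (λ z → c * z + F A)
          (alt i j i≢j B
          (λ l → trans (B-i l) (sym (trans (B-else j (i≢j ∘ sym) l) (C-else j (i≢j ∘ sym) l))))) ⟩
    c * 0ℤ + F A    ≡⟨ lem c (F A) ⟩
    F A             ∎
    where
    lem : ∀ c a → c * 0ℤ + a ≡ a
    lem = solve-∀
    B : Matrix n n
    B k = if does (k ≟ i) then A j else C k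
    B-i : B i ≗ A j
    B-i l rewrite dec-true (i ≟ i) refl = refl
    B-else : ∀ k → k ≢ i → B k ≗ C k
    B-else k k≢i l rewrite dec-false (k ≟ i) k≢i = refl

  -- Adding multiples of row j to all other rows does not change F: the rows are
  -- changed one after the other, those with index less than p in the matrix M p.
  F-addMultiples : ∀ j (c : Vector ℤ n) {A C : Matrix n n} → C j ≗ A j →
                   (∀ k l → k ≢ j → C k l ≡ c k * A j l + A k l) → F C ≡ F A
  F-addMultiples j c {A} {C} Cj C-else = begin
    F C      ≡⟨ F-cong (λ k l → sym (cong-app (M-< n k (toℕ<n k)) l)) ⟩
    F (M n)  ≡⟨ chain n ℕ.≤-refl ⟩
    F (M 0)  ≡⟨ F-cong (λ k l → cong-app (M-≮ 0 k λ ()) l) ⟩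
    F A      ∎
    where
    M : ℕ → Matrix n n
    M p k = if does (toℕ k ℕ.<? p) then C k else A k
    M-< : ∀ p k → toℕ k ℕ.< p → M p k ≡ C k
    M-< p k lt rewrite dec-true (toℕ k ℕ.<? p) lt = refl
    M-≮ : ∀ p k → toℕ k ℕ.≮ p → M p k ≡ A k
    M-≮ p k nlt rewrite dec-false (toℕ k ℕ.<? p) nlt = refl
    M-j : ∀ p → M p j ≗ A j
    M-j p l with toℕ j ℕ.<? p
    ... | yes lt  = trans (cong-app (M-< p j lt) l) (Cj l)
    ... | no  nlt = cong-app (M-≮ p j nlt) l
    step : ∀ i → F (M (suc (toℕ i))) ≡ F (M (toℕ i))
    step i with i ≟ j
    ... | yes refl = F-cong same
      where
      same : ∀ k l → M (suc (toℕ i)) k l ≡ M (toℕ i) k l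
      same k l with k ≟ i
      ... | yes refl = trans (M-j (suc (toℕ i)) l) (sym (M-j (toℕ i) l))
      ... | no k≢i with toℕ k ℕ.<? toℕ i
      ... | yes lt = cong-app (trans (M-< (suc (toℕ i)) k (ℕ.m<n⇒m<1+n lt)) (sym (M-< (toℕ i) k lt))) l
      ... | no nlt = cong-app
          (trans (M-≮ (suc (toℕ i)) k (λ lt → nlt (ℕ.≤∧≢⇒< (ℕ.s≤s⁻¹ lt) (k≢i ∘ toℕ-injective))))
          (sym (M-≮ (toℕ i) k nlt))) l
    ... | no i≢j = F-addMultiple {i} {j} (c i) i≢j else′
      (λ l → trans (cong-app (M-< (suc (toℕ i)) i ℕ.≤-refl) l) (trans (C-else i l i≢j)
        (cong₂ (λ x y → c i * x + y) (sym (M-j (toℕ i) l))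
            (sym (cong-app (M-≮ (toℕ i) i (ℕ.<-irrefl refl)) l)))))
      where
      else′ : ∀ k → k ≢ i → M (suc (toℕ i)) k ≗ M (toℕ i) k
      else′ k k≢i l with toℕ k ℕ.<? toℕ i
      ... | yes lt = cong-app (trans (M-< (suc (toℕ i)) k (ℕ.m<n⇒m<1+n lt)) (sym (M-< (toℕ i) k lt))) l
      ... | no nlt = cong-app
          (trans (M-≮ (suc (toℕ i)) k (λ lt → nlt (ℕ.≤∧≢⇒< (ℕ.s≤s⁻¹ lt) (k≢i ∘ toℕ-injective))))
          (sym (M-≮ (toℕ i) k nlt))) l
    chain : ∀ p → p ℕ.≤ n → F (M p) ≡ F (M 0)
    chain zero    _   = refl
    chain (suc p) p<n = trans (subst (λ q → F (M (suc q)) ≡ F (M q)) (toℕ-fromℕ< p<n) (step (fromℕ< p<n)))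
        (chain p (ℕ.<⇒≤ p<n))

module _ {n} {F : Matrix (suc n) (suc n) → ℤ} (lin : RowLinear F) where
  open RowLinear lin

  -- Expansion of F along a first row that is a linear combination.
  F-sumRow : ∀ {N} (c : Vector ℤ N) (vs : Matrix N (suc n)) (R : Matrix n (suc n)) →
             F ((λ l → sum (λ j → c j * vs j l)) ∷ R) ≡ sum (λ j → c j * F (vs j ∷ R))
  F-sumRow {zero}  c vs R = row-zero lin zero (λ _ → refl)
  F-sumRow {suc N} c vs R = trans
    (F-linear zero
        (c zero) {vs zero ∷ R} {(λ l → sum (λ j → c (suc j) * vs (suc j) l)) ∷ R} {(λ l → sum (λ j → c j * vs j l)) ∷ R} (else (vs zero) _) (else _ _) (λ _ → refl))
    (cong (c zero * F (vs zero ∷ R) +_) (F-sumRow (c ∘ suc) (vs ∘ suc) R))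
    where
    else : ∀ (v w : Vector ℤ (suc n)) k → k ≢ zero → (v ∷ R) k ≗ (w ∷ R) k
    else v w zero    ne _ = contradiction refl ne
    else v w (suc k) _  _ = refl

-- Insertion of the entry 0 at position j.
insertZero : ∀ {n} → Fin (suc n) → Vector ℤ n → Vector ℤ (suc n)
insertZero j w = insertAt w j 0ℤ

insertZero-cong : ∀ {n} (j : Fin (suc n)) {v w : Vector ℤ n} → v ≗ w → insertZero j v ≗ insertZero j w
insertZero-cong j {v} {w} v≗w l with punchIn-view j l
... | inj₁ refl = trans (insertAt-lookup v j 0ℤ) (sym (insertAt-lookup w j 0ℤ))
... | inj₂ (k , refl) = trans (insertAt-punchIn v j 0ℤ k) (trans (v≗w k) (sym (insertAt-punchIn w j 0ℤ k)))

insertZero-linear : ∀ {n} (j : Fin (suc n)) s (v w : Vector ℤ n) l →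
  insertZero j (λ k → s * v k + w k) l ≡ s * insertZero j v l + insertZero j w l
insertZero-linear j s v w l with punchIn-view j l
... | inj₁ refl = trans (insertAt-lookup (λ k → s * v k + w k) j 0ℤ)
                  (trans (lem s)
                      (cong₂ (λ x y → s * x + y) (sym (insertAt-lookup v j 0ℤ))
                      (sym (insertAt-lookup w j 0ℤ))))
  where
  lem : ∀ s → 0ℤ ≡ s * 0ℤ + 0ℤ
  lem = solve-∀
... | inj₂ (k , refl) = trans (insertAt-punchIn (λ k → s * v k + w k) j 0ℤ k)
  (cong₂ (λ x y → s * x + y) (sym (insertAt-punchIn v j 0ℤ k)) (sym (insertAt-punchIn w j 0ℤ k)))

insertZero-identity : ∀ {n} (j : Fin (suc n)) k → insertZero j (identity k) ≗ identity (punchIn j k)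
insertZero-identity j k l with punchIn-view j l
... | inj₁ refl = trans (insertAt-lookup (identity k) j 0ℤ) (sym (identity-off (punchInᵢ≢i j k)))
... | inj₂ (l′ , refl) = trans (insertAt-punchIn (identity k) j 0ℤ l′) lem
  where
  lem : identity k l′ ≡ identity (punchIn j k) (punchIn j l′)
  lem with k ≟ l′
  ... | yes refl = sym (identity-diag (punchIn j k))
  ... | no  k≢l′ = sym (identity-off (k≢l′ ∘ Fin.punchIn-injective j k l′))

punchIn-inject₁-self : ∀ {n} (j : Fin n) → punchIn (inject₁ j) j ≡ suc j
punchIn-inject₁-self zero    = refl
punchIn-inject₁-self (suc j) = cong suc (punchIn-inject₁-self j)

punchIn-suc-self : ∀ {n} (j : Fin n) → punchIn (suc j) j ≡ inject₁ j
punchIn-suc-self zero    = refl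
punchIn-suc-self (suc j) = cong suc (punchIn-suc-self j)

punchIn-suc-other : ∀ {n} {j k : Fin n} → k ≢ j → punchIn (suc j) k ≡ punchIn (inject₁ j) k
punchIn-suc-other {j = zero}  {zero}  k≢j = contradiction refl k≢j
punchIn-suc-other {j = zero}  {suc k} k≢j = refl
punchIn-suc-other {j = suc j} {zero}  k≢j = refl
punchIn-suc-other {j = suc j} {suc k} k≢j = cong suc (punchIn-suc-other (k≢j ∘ cong suc))

module _ {n} {F : Matrix (suc n) (suc n) → ℤ} (lin : RowLinear F)
    (alt : ∀ i j → i ≢ j → Alternating F i j) where
  open RowLinear lin

  -- The identity matrix with row j moved to the top.
  cycle : Fin (suc n) → Matrix (suc n) (suc n)
  cycle j = identity j ∷ λ k → identity (punchIn j k)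

  -- Moving row j + 1 instead of row j to the top amounts to exchanging the first
  -- row and row j + 1 afterwards.
  F-cycle : ∀ j → F (cycle j) ≡ sgn j * F identity
  F-cycle = <-weakInduction (λ j → F (cycle j) ≡ sgn j * F identity)
    (trans (F-cong λ { zero l → refl ; (suc k) l → refl }) (sym (ℤ.*-identityˡ (F identity))))
    λ j ih → begin
      F (cycle (suc j))                ≡⟨ swap-rows lin {zero} {suc j} (λ ()) (alt zero (suc j) λ ())
                                            (λ l → cong (λ i → identity i l) (sym (punchIn-inject₁-self j)))
                                            (λ l → cong (λ i → identity i l) (punchIn-suc-self j))
                                            (λ { zero ne → contradiction refl ne
                                               ; (suc k) _ ne l → cong (λ i → identity i l)
                                                   (punchIn-suc-other (ne ∘ cong suc)) }) ⟩
      - F (cycle (inject₁ j))          ≡⟨ cong -_ ih ⟩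
      - (sgn (inject₁ j) * F identity) ≡⟨ cong (λ i → - (-1ℤ ^ i * F identity)) (toℕ-inject₁ j) ⟩
      - (sgn j * F identity)           ≡⟨ lem (sgn j) (F identity) ⟩
      -1ℤ * sgn j * F identity         ∎
    where
    lem : ∀ s f → - (s * f) ≡ -1ℤ * s * f
    lem = solve-∀

  -- B with an additional first row and an additional column j, which have the
  -- entry 1 in common and are 0 elsewhere.
  border : Fin (suc n) → Matrix n n → Matrix (suc n) (suc n)
  border j B = identity j ∷ λ k → insertZero j (B k)

  -- When the first row is a unit vector, its multiples clear column j in all other
  -- rows.
  F-border : ∀ j A → F (identity j ∷ λ k → A (suc k)) ≡ F (border j (minor A j))
  F-border j A = F-addMultiples lin alt zero (λ { zero → 0ℤ ; (suc k) → A (suc k) j }) (λ _ → refl)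
    λ { zero l ne → contradiction refl ne ; (suc k) l _ → entry k l }
    where
    entry : ∀ k l → A (suc k) l ≡ A (suc k) j * identity j l + insertZero j (minor A j k) l
    entry k l with punchIn-view j l
    ... | inj₁ refl = trans (lem (A (suc k) j))
        (cong₂ (λ x y → A (suc k) j * x + y) (sym (identity-diag j))
        (sym (insertAt-lookup (minor A j k) j 0ℤ)))
      where
      lem : ∀ a → a ≡ a * 1ℤ + 0ℤ
      lem = solve-∀
    ... | inj₂ (l′ , refl) = trans (lem (A (suc k) j) (A (suc k) l)) (cong₂ (λ x y → A (suc k) j * x + y)
             (sym (identity-off {i = j} (punchInᵢ≢i j l′ ∘ sym)))
                 (sym (insertAt-punchIn (minor A j k) j 0ℤ l′)))
      where
      lem : ∀ a b → b ≡ a * 0ℤ + b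
      lem = solve-∀

  border-rowLinear : ∀ j → RowLinear (F ∘ border j)
  border-rowLinear j = record
    { F-cong = λ A≡B → F-cong λ { zero l → refl ; (suc k) → insertZero-cong j (A≡B k) }
    ; F-linear = λ i s {A} {B} {C} A≗C B≗C Ci → F-linear (suc i) s
        (λ { zero _ _ → refl ; (suc k) ne → insertZero-cong j (A≗C k (ne ∘ cong suc)) })
        (λ { zero _ _ → refl ; (suc k) ne → insertZero-cong j (B≗C k (ne ∘ cong suc)) })
        λ l → trans (insertZero-cong j Ci l) (insertZero-linear j s (A i) (B i) l)
    }

  border-alternating : ∀ j i i′ → i ≢ i′ → Alternating (F ∘ border j) i i′
  border-alternating j i i′ i≢i′ A Aᵢ≗Aᵢ′ = alt (suc i) (suc i′) (i≢i′ ∘ suc-injective) (border j A)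
      (insertZero-cong j Aᵢ≗Aᵢ′)

  F-border-identity : ∀ j → F (border j identity) ≡ sgn j * F identity
  F-border-identity j = trans (F-cong λ { zero l → refl ; (suc k) → insertZero-identity j k }) (F-cycle j)

-- A multilinear alternating function of the rows is determined by its value at the
-- identity.  Expanding F along the first row leaves the functions F (border j B) of
-- smaller matrices B, which are again multilinear and alternating.
det-unique : ∀ {n} {F : Matrix n n → ℤ} → RowLinear F → (∀ i j → i ≢ j → Alternating F i j) →
             ∀ A → F A ≡ det A * F identity
det-unique {zero}  {F} lin alt A = trans (RowLinear.F-cong lin λ ()) (sym (ℤ.*-identityˡ (F identity)))
det-unique {suc n} {F} lin alt A = begin
  F A
    ≡⟨ F-cong (λ { zero l → sym (trans (sum-cong-≗ λ j → cong (A zero j *_) (identity-sym j l)) (trans (sum-cong-≗ λ j → ℤ.*-comm (A zero j) (identity l j)) (identity-· (A zero) l))) ; (suc k) l → refl }) ⟩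
  F ((λ l → sum (λ j → A zero j * identity j l)) ∷ λ k → A (suc k))
    ≡⟨ F-sumRow lin (A zero) identity (λ k → A (suc k)) ⟩
  sum (λ j → A zero j * F (identity j ∷ λ k → A (suc k)))
    ≡⟨ sum-cong-≗ term ⟩
  sum (λ j → sgn j * A zero j * det (minor A j) * F identity)
    ≡⟨ *-distribʳ-sum (F identity) (λ j → sgn j * A zero j * det (minor A j)) ⟨
  det A * F identity ∎
  where
  open RowLinear lin
  lem : ∀ a d s f → a * (d * (s * f)) ≡ s * a * d * f
  lem = solve-∀
  term : ∀ j → A zero j * F (identity j ∷ λ k → A (suc k)) ≡ sgn j * A zero j * det (minor A j) * F identity
  term j = begin
    A zero j * F (identity j ∷ λ k → A (suc k))               ≡⟨ cong (A zero j *_) (F-border lin alt j A) ⟩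
    A zero j * F (border lin alt j (minor A j))
      ≡⟨ cong (A zero j *_)
          (det-unique (border-rowLinear lin alt j) (border-alternating lin alt j) (minor A j)) ⟩
    A zero j * (det (minor A j) * F (border lin alt j identity))
      ≡⟨ cong (λ z → A zero j * (det (minor A j) * z)) (F-border-identity lin alt j) ⟩
    A zero j * (det (minor A j) * (sgn j * F identity))
      ≡⟨ lem (A zero j) (det (minor A j)) (sgn j) (F identity) ⟩
    _ ∎

-- By uniqueness, applied to A ↦ det (A ∙ B).
det-∙ : ∀ {n} (A B : Matrix n n) → det (A ∙ B) ≡ det A * det B
det-∙ A B = trans
    (det-unique {F = λ A → det (A ∙ B)} lin
    (λ i j i≢j A Aᵢ≗Aⱼ → det-alt i j i≢j (A ∙ B) (λ l → row Aᵢ≗Aⱼ l)) A)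
                  (cong (det A *_) (det-cong λ i k → identity-· (λ j → B j k) i))
  where
  row : ∀ {v w : Vector ℤ _} → v ≗ w → ∀ l → sum (λ j → v j * B j l) ≡ sum (λ j → w j * B j l)
  row v≗w l = sum-cong-≗ λ j → cong (_* B j l) (v≗w j)
  lem : ∀ s a b c → (s * a + b) * c ≡ s * (a * c) + b * c
  lem = solve-∀
  lin : RowLinear (λ A → det (A ∙ B))
  lin = record
    { F-cong = λ A≡A′ → det-cong λ i → row (A≡A′ i)
    ; F-linear = λ i s {A} {A′} {C} A≗C A′≗C Ci → det-linear i s (λ k ne → row (A≗C k ne))
        (λ k ne → row (A′≗C k ne))
        λ l → trans (sum-cong-≗ λ j → trans (cong (_* B j l) (Ci j)) (lem s (A i j) (A′ i j) (B j l)))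
                    (sum-linear s (λ j → A i j * B j l) (λ j → A′ i j * B j l))
    }

-- Block matrices

sum-split : ∀ p {q} (f : Vector ℤ (p ℕ.+ q)) → sum f ≡ sum (λ i → f (i ↑ˡ q)) + sum (λ j → f (p ↑ʳ j))
sum-split zero    f = sym (ℤ.+-identityˡ (sum f))
sum-split (suc p) f = trans (cong (f zero +_) (sum-split p (f ∘ suc))) (sym (ℤ.+-assoc (f zero) _ _))

sum-combine : ∀ m {n} (f : Vector ℤ (m ℕ.* n)) → sum f ≡ sum (λ a → sum (λ i → f (combine {m} {n} a i)))
sum-combine zero        f = refl
sum-combine (suc m) {n} f = trans (sum-split n f)
    (cong (sum (λ i → f (i ↑ˡ m ℕ.* n)) +_) (sum-combine m (λ x → f (n ↑ʳ x))))

punchIn-↑ˡ : ∀ {p} q (j : Fin (suc p)) l → punchIn (j ↑ˡ q) (l ↑ˡ q) ≡ punchIn j l ↑ˡ q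
punchIn-↑ˡ q zero    l       = refl
punchIn-↑ˡ q (suc j) zero    = refl
punchIn-↑ˡ q (suc j) (suc l) = cong suc (punchIn-↑ˡ q j l)

punchIn-↑ʳ : ∀ {p} q (j : Fin (suc p)) (l : Fin q) → punchIn (j ↑ˡ q) (p ↑ʳ l) ≡ suc p ↑ʳ l
punchIn-↑ʳ         q zero    l = refl
punchIn-↑ʳ {suc p} q (suc j) l = cong suc (punchIn-↑ʳ q j l)

-- The determinant of a block lower triangular matrix.
det-block : ∀ p {q} (M : Matrix (p ℕ.+ q) (p ℕ.+ q)) → (∀ i j → M (i ↑ˡ q) (p ↑ʳ j) ≡ 0ℤ) →
            det M ≡ det (λ i j → M (i ↑ˡ q) (j ↑ˡ q)) * det (λ i j → M (p ↑ʳ i) (p ↑ʳ j))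
det-block zero    M M≡0 = sym (ℤ.*-identityˡ _)
det-block (suc p) {q} M M≡0 = begin
  det M
    ≡⟨ sum-split (suc p) f ⟩
  sum (λ j → f (j ↑ˡ q)) + sum (λ j → f (suc p ↑ʳ j))
    ≡⟨ cong₂ _+_ (sum-cong-≗ left) (sum-zero right) ⟩
  sum (λ j → g j * det D) + 0ℤ
    ≡⟨ ℤ.+-identityʳ _ ⟩
  sum (λ j → g j * det D)
    ≡⟨ *-distribʳ-sum (det D) g ⟨
  det A * det D ∎
  where
  A : Matrix (suc p) (suc p)
  A i j = M (i ↑ˡ q) (j ↑ˡ q)
  D : Matrix q q
  D i j = M (suc p ↑ʳ i) (suc p ↑ʳ j)
  f : Vector ℤ (suc p ℕ.+ q)
  f j = sgn j * M zero j * det (minor M j)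
  g : Vector ℤ (suc p)
  g j = sgn j * A zero j * det (minor A j)
  right : ∀ j → f (suc p ↑ʳ j) ≡ 0ℤ
  right j = trans (cong (λ z → sgn (suc p ↑ʳ j) * z * det (minor M (suc p ↑ʳ j))) (M≡0 zero j))
      (lem (sgn (suc p ↑ʳ j)) (det (minor M (suc p ↑ʳ j))))
    where
    lem : ∀ s d → s * 0ℤ * d ≡ 0ℤ
    lem = solve-∀
  minor-block : ∀ j → det (minor M (j ↑ˡ q)) ≡ det (minor A j) * det D
  minor-block j = trans
      (det-block p (minor M (j ↑ˡ q))
      (λ k l → trans (cong (M (suc (k ↑ˡ q))) (punchIn-↑ʳ q j l)) (M≡0 (suc k) l)))
    (cong₂ _*_ (det-cong λ k l → cong (M (suc (k ↑ˡ q))) (punchIn-↑ˡ q j l))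
        (det-cong λ k l → cong (M (suc (p ↑ʳ k))) (punchIn-↑ʳ q j l)))
  left : ∀ j → f (j ↑ˡ q) ≡ g j * det D
  left j = trans (cong₂ (λ s d → -1ℤ ^ s * A zero j * d) (Fin.toℕ-↑ˡ j q) (minor-block j))
      (sym (ℤ.*-assoc (sgn j * A zero j) _ _))

det-identity : ∀ {n} → det (identity {n}) ≡ 1ℤ
det-identity {zero}  = refl
det-identity {suc n} = begin
  det (identity {suc n})           ≡⟨ det-block 1 {n} identity (λ { zero j → refl }) ⟩
  det {1} (λ i j → identity {suc n} (i ↑ˡ n) (j ↑ˡ n)) * det (λ i j → identity {suc n} (suc i) (suc j))
    ≡⟨ cong (1ℤ *_) (det-cong {n} {λ i j → identity {suc n} (suc i) (suc j)} {identity} λ i j → refl) ⟩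
  1ℤ * det (identity {n})          ≡⟨ ℤ.*-identityˡ _ ⟩
  det (identity {n})               ≡⟨ det-identity {n} ⟩
  1ℤ                               ∎

-- The block diagonal matrix with blocks B 0, ..., B (m - 1).  Block indices are
-- natural numbers, so that the sequence of blocks can be shifted.
blockDiagonal : ∀ m {n} → (ℕ → Matrix n n) → Matrix (m ℕ.* n) (m ℕ.* n)
blockDiagonal m {n} B x y =
  identity (quotient {m} n x) (quotient {m} n y) * B (toℕ (quotient {m} n y)) (remainder {m} n x)
      (remainder {m} n y)

-- The product of the determinants of the first m blocks.
det-blocks : ∀ {n} → ℕ → (ℕ → Matrix n n) → ℤ
det-blocks zero    B = 1ℤ
det-blocks (suc m) B = det (B zero) * det-blocks m (B ∘ suc)

blockDiagonal-combine : ∀ {m n} (B : ℕ → Matrix n n) (a b : Fin m) i j →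
  blockDiagonal m B (combine a i) (combine b j) ≡ identity a b * B (toℕ b) i j
blockDiagonal-combine B a b i j = cong₂ (λ (a , i) (b , j) → identity a b * B (toℕ b) i j)
    (remQuot-combine a i) (remQuot-combine b j)

combine-ind : ∀ {m n} (P : Fin (m ℕ.* n) → Set) → (∀ a i → P (combine {m} {n} a i)) → ∀ x → P x
combine-ind {m} {n} P p x = subst P (combine-remQuot {m} n x) (p (quotient {m} n x) (remainder {m} n x))

det-blockDiagonal : ∀ m {n} (B : ℕ → Matrix n n) → det (blockDiagonal m B) ≡ det-blocks m B
det-blockDiagonal zero    B = refl
det-blockDiagonal (suc m) {n} B = begin
  det (blockDiagonal (suc m) B)
    ≡⟨ det-block n (blockDiagonal (suc m) B)
        (λ i → combine-ind {m} {n} (λ x → blockDiagonal (suc m) B (i ↑ˡ m ℕ.* n) (n ↑ʳ x) ≡ 0ℤ)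
         λ b j → trans (blockDiagonal-combine {suc m} B zero (suc b) i j) (ℤ.*-zeroˡ (B (toℕ (suc b)) i j))) ⟩
  _ ≡⟨ cong₂ _*_
      (det-cong λ i j → trans (blockDiagonal-combine {suc m} B zero zero i j) (ℤ.*-identityˡ (B 0 i j)))
                 (trans (det-cong (combine-ind {m} {n} _ λ a i → combine-ind {m} {n} _ λ b j →
                    trans (blockDiagonal-combine {suc m} B (suc a) (suc b) i j)
                        (sym (blockDiagonal-combine {m} (B ∘ suc) a b i j))))
                  (det-blockDiagonal m (B ∘ suc))) ⟩
  det (B zero) * det-blocks m (B ∘ suc) ∎

-- Column spaces and divisibility of determinants

-- The integer combinations of the columns of A.
record _∈col_ {m n} (v : Vector ℤ m) (A : Matrix m n) : Set where
  constructor _,_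
  field
    coefficients : Vector ℤ n
    combination  : v ≗ A · coefficients

-- If the columns of B are combinations of those of A, then B = A C for a matrix C.
det-∣-det : ∀ {n} {A B : Matrix n n} → (∀ k → (λ i → B i k) ∈col A) → det A ∣ det B
det-∣-det {A = A} {B} cols = divides (det C) (begin
  det B          ≡⟨ det-cong {A = B} {A ∙ C} (λ i k → _∈col_.combination (cols k) i) ⟩
  det (A ∙ C)    ≡⟨ det-∙ A C ⟩
  det A * det C  ≡⟨ ℤ.*-comm (det A) (det C) ⟩
  det C * det A  ∎)
  where
  C : Matrix _ _
  C j k = _∈col_.coefficients (cols k) j

-- Mutual divisibility, which is equality up to sign.
infix 4 _∼_
_∼_ : ℤ → ℤ → Set
i ∼ j = i ∣ j × j ∣ i

∼⇒± : ∀ {i j} → i ∼ j → i ≡ j ⊎ i ≡ - j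
∼⇒± {i} {j} (i∣j , j∣i) = absolute i j (ℕ.∣-antisym (∣⇒∣ᵤ i∣j) (∣⇒∣ᵤ j∣i))
  where
  absolute : ∀ i j → ℤ.∣ i ∣ ≡ ℤ.∣ j ∣ → i ≡ j ⊎ i ≡ - j
  absolute (ℤ.+ m)      (ℤ.+ .m)      refl = inj₁ refl
  absolute (ℤ.+ suc m)  (ℤ.-[1+ .m ]) refl = inj₂ refl
  absolute (ℤ.-[1+ m ]) (ℤ.+ .(suc m))  refl = inj₂ refl
  absolute (ℤ.-[1+ m ]) (ℤ.-[1+ .m ]) refl = inj₁ refl

∼-reflexive : ∀ {i j} → i ≡ j → i ∼ j
∼-reflexive refl = ∣-reflexive refl , ∣-reflexive refl

∼-trans : ∀ {i j k} → i ∼ j → j ∼ k → i ∼ k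
∼-trans (i∣j , j∣i) (j∣k , k∣j) = ∣-trans i∣j j∣k , ∣-trans k∣j j∣i

∣-* : ∀ {i j k l} → i ∣ j → k ∣ l → i * k ∣ j * l
∣-* {i} {k = k} (divides p refl) (divides q refl) = divides (p * q) (lem p i q k)
  where
  lem : ∀ p i q k → p * i * (q * k) ≡ p * q * (i * k)
  lem = solve-∀

∼-* : ∀ {i j k l} → i ∼ j → k ∼ l → i * k ∼ j * l
∼-* (i∣j , j∣i) (k∣l , l∣k) = ∣-* i∣j k∣l , ∣-* j∣i l∣k

-- The ring generated by two commuting matrices

·-+ : ∀ {m n} (A : Matrix m n) v w → A · (λ j → v j + w j) ≗ λ i → (A · v) i + (A · w) i
·-+ A v w i = trans (sum-cong-≗ λ j → ℤ.*-distribˡ-+ (A i j) (v j) (w j))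
    (∑-distrib-+ (λ j → A i j * v j) (λ j → A i j * w j))

·-* : ∀ {m n} (A : Matrix m n) s v → A · (λ j → s * v j) ≗ λ i → s * (A · v) i
·-* A s v i = trans (sum-cong-≗ λ j → lem (A i j) s (v j)) (sym (*-distribˡ-sum s (λ j → A i j * v j)))
  where
  lem : ∀ a s v → a * (s * v) ≡ s * (a * v)
  lem = solve-∀

-- The commutative ring of the integer polynomials in two commuting matrices.  Its
-- elements are polynomial expressions, compared by their action on vectors.
module Operators {N} (𝑇 𝑋 : Matrix N N) (𝑇𝑋-comm : ∀ v → 𝑇 · 𝑋 · v ≗ 𝑋 · 𝑇 · v) where

  -- con c is the constant c; 𝕥 and 𝕩 stand for the two matrices.
  infixl 6 _⊞_
  infixl 7 _⊠_
  data Expr : Set where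
    con     : ℤ → Expr
    𝕥 𝕩     : Expr
    _⊞_ _⊠_ : Expr → Expr → Expr

  -- The action of an expression on vectors.
  ⟦_⟧ : Expr → Vector ℤ N → Vector ℤ N
  ⟦ con c ⟧ v   = λ i → c * v i
  ⟦ 𝕥 ⟧ v       = 𝑇 · v
  ⟦ 𝕩 ⟧ v       = 𝑋 · v
  ⟦ e ⊞ f ⟧ v   = λ i → ⟦ e ⟧ v i + ⟦ f ⟧ v i
  ⟦ e ⊠ f ⟧ v   = ⟦ e ⟧ (⟦ f ⟧ v)

  -- The matrix of that action.
  matrix : Expr → Matrix N N
  matrix (con c) i j = c * identity i j
  matrix 𝕥           = 𝑇
  matrix 𝕩           = 𝑋
  matrix (e ⊞ f)     = matrix e ⊕ matrix f
  matrix (e ⊠ f)     = matrix e ∙ matrix f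

  matrix-· : ∀ e v → ⟦ e ⟧ v ≗ matrix e · v
  matrix-· (con c) v i = sym (trans (sum-cong-≗ λ j → ℤ.*-assoc c (identity i j) (v j))
                              (trans (sym (*-distribˡ-sum c (λ j → identity i j * v j)))
                                  (cong (c *_) (identity-· v i))))
  matrix-· 𝕥 v i = refl
  matrix-· 𝕩 v i = refl
  matrix-· (e ⊞ f) v i = trans (cong₂ _+_ (matrix-· e v i) (matrix-· f v i))
    (trans (sym (∑-distrib-+ (λ j → matrix e i j * v j) (λ j → matrix f i j * v j)))
           (sum-cong-≗ λ j → sym (ℤ.*-distribʳ-+ (v j) (matrix e i j) (matrix f i j))))
  matrix-· (e ⊠ f) v i = trans (matrix-· e (⟦ f ⟧ v) i)
    (trans (·-cong (matrix e) (matrix-· f v) i) (sym (∙-· (matrix e) (matrix f) v i)))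

  ⟦⟧-cong : ∀ e {v w} → v ≗ w → ⟦ e ⟧ v ≗ ⟦ e ⟧ w
  ⟦⟧-cong e v≗w i = trans (matrix-· e _ i) (trans (·-cong (matrix e) v≗w i) (sym (matrix-· e _ i)))

  ⟦⟧-+ : ∀ e v w → ⟦ e ⟧ (λ j → v j + w j) ≗ λ i → ⟦ e ⟧ v i + ⟦ e ⟧ w i
  ⟦⟧-+ e v w i = trans (matrix-· e _ i)
      (trans (·-+ (matrix e) v w i) (sym (cong₂ _+_ (matrix-· e v i) (matrix-· e w i))))

  ⟦⟧-* : ∀ e s v → ⟦ e ⟧ (λ j → s * v j) ≗ λ i → s * ⟦ e ⟧ v i
  ⟦⟧-* e s v i = trans (matrix-· e _ i) (trans (·-* (matrix e) s v i) (sym (cong (s *_) (matrix-· e v i))))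

  private
    comm-𝕥 : ∀ e v → ⟦ e ⟧ (𝑇 · v) ≗ 𝑇 · ⟦ e ⟧ v
    comm-𝕥 (con c) v i = sym (·-* 𝑇 c v i)
    comm-𝕥 𝕥       v i = refl
    comm-𝕥 𝕩       v i = sym (𝑇𝑋-comm v i)
    comm-𝕥 (e ⊞ f) v i = trans (cong₂ _+_ (comm-𝕥 e v i) (comm-𝕥 f v i)) (sym (·-+ 𝑇 (⟦ e ⟧ v) (⟦ f ⟧ v) i))
    comm-𝕥 (e ⊠ f) v i = trans (⟦⟧-cong e (comm-𝕥 f v) i) (comm-𝕥 e (⟦ f ⟧ v) i)

    comm-𝕩 : ∀ e v → ⟦ e ⟧ (𝑋 · v) ≗ 𝑋 · ⟦ e ⟧ v
    comm-𝕩 (con c) v i = sym (·-* 𝑋 c v i)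
    comm-𝕩 𝕥       v i = 𝑇𝑋-comm v i
    comm-𝕩 𝕩       v i = refl
    comm-𝕩 (e ⊞ f) v i = trans (cong₂ _+_ (comm-𝕩 e v i) (comm-𝕩 f v i)) (sym (·-+ 𝑋 (⟦ e ⟧ v) (⟦ f ⟧ v) i))
    comm-𝕩 (e ⊠ f) v i = trans (⟦⟧-cong e (comm-𝕩 f v) i) (comm-𝕩 e (⟦ f ⟧ v) i)

  ⟦⟧-comm : ∀ e f v → ⟦ e ⟧ (⟦ f ⟧ v) ≗ ⟦ f ⟧ (⟦ e ⟧ v)
  ⟦⟧-comm e (con c) v i = ⟦⟧-* e c v i
  ⟦⟧-comm e 𝕥       v i = comm-𝕥 e v i
  ⟦⟧-comm e 𝕩       v i = comm-𝕩 e v i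
  ⟦⟧-comm e (f ⊞ g) v i = trans (⟦⟧-+ e (⟦ f ⟧ v) (⟦ g ⟧ v) i) (cong₂ _+_ (⟦⟧-comm e f v i) (⟦⟧-comm e g v i))
  ⟦⟧-comm e (f ⊠ g) v i = trans (⟦⟧-comm e f (⟦ g ⟧ v) i) (⟦⟧-cong f (⟦⟧-comm e g v) i)

  -- Equality of the actions.
  infix 4 _≋_
  record _≋_ (e f : Expr) : Set where
    constructor equal
    field at : ∀ v → ⟦ e ⟧ v ≗ ⟦ f ⟧ v
  open _≋_ public

  commutativeRing : CommutativeRing 0ℓ 0ℓ
  commutativeRing = record
    { Carrier = Expr ; _≈_ = _≋_ ; _+_ = _⊞_ ; _*_ = _⊠_ ; -_ = con -1ℤ ⊠_ ; 0# = con 0ℤ ; 1# = con 1ℤ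
    ; isCommutativeRing = record
      { isRing = record
        { +-isAbelianGroup = record
          { isGroup = record
            { isMonoid = record
              { isSemigroup = record
                { isMagma = record
                  { isEquivalence = record
                    { refl  = equal λ v i → refl
                    ; sym   = λ p → equal λ v i → sym (at p v i)
                    ; trans = λ p q → equal λ v i → trans (at p v i) (at q v i) }
                  ; ∙-cong = λ p q → equal λ v i → cong₂ _+_ (at p v i) (at q v i) }
                ; assoc = λ e f g → equal λ v i → ℤ.+-assoc (⟦ e ⟧ v i) (⟦ f ⟧ v i) (⟦ g ⟧ v i) }
              ; identity =
                  (λ e → equal λ v i → trans (cong (_+ ⟦ e ⟧ v i) (ℤ.*-zeroˡ (v i))) (ℤ.+-identityˡ _))
                         , (λ e → equal λ v i → trans (cong (⟦ e ⟧ v i +_) (ℤ.*-zeroˡ (v i)))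
                             (ℤ.+-identityʳ _)) }
            ; inverse = (λ e → equal λ v i → trans (inverse (⟦ e ⟧ v i)) (sym (ℤ.*-zeroˡ (v i))))
                      , (λ e → equal λ v i → trans (ℤ.+-comm (⟦ e ⟧ v i) _)
                          (trans (inverse (⟦ e ⟧ v i)) (sym (ℤ.*-zeroˡ (v i)))))
            ; ⁻¹-cong = λ p → equal λ v i → cong (-1ℤ *_) (at p v i) }
          ; comm = λ e f → equal λ v i → ℤ.+-comm (⟦ e ⟧ v i) (⟦ f ⟧ v i) }
        ; *-cong = λ {e} {e′} {f} {f′} p q → equal λ v i → trans (⟦⟧-cong e (at q v) i) (at p (⟦ f′ ⟧ v) i)
        ; *-assoc = λ e f g → equal λ v i → refl
        ; *-identity = (λ e → equal λ v i → ℤ.*-identityˡ (⟦ e ⟧ v i)) ,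
            (λ e → equal λ v i → ⟦⟧-cong e (λ j → ℤ.*-identityˡ (v j)) i)
        ; distrib = (λ e f g → equal λ v i → ⟦⟧-+ e (⟦ f ⟧ v) (⟦ g ⟧ v) i) , (λ e f g → equal λ v i → refl)
        }
      ; *-comm = λ e f → equal λ v i → ⟦⟧-comm e f v i
      }
    }
    where
    inverse : ∀ a → -1ℤ * a + a ≡ 0ℤ
    inverse = solve-∀

  constants : +-*-rawRing -Raw-AlmostCommutative⟶ fromCommutativeRing commutativeRing
  constants = record
    { ⟦_⟧    = con
    ; +-homo = λ c d → equal λ v i → ℤ.*-distribʳ-+ (v i) c d
    ; *-homo = λ c d → equal λ v i → ℤ.*-assoc c d (v i)
    ; -‿homo = λ c → equal λ v i → neg c (v i)
    ; 0-homo = equal λ v i → refl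
    ; 1-homo = equal λ v i → refl
    }
    where
    neg : ∀ c v → (- c) * v ≡ -1ℤ * (c * v)
    neg = solve-∀

  matrix-column : ∀ e k → ⟦ e ⟧ (λ i → identity i k) ≗ λ i → matrix e i k
  matrix-column e k i = trans (matrix-· e _ i) (·-identity (matrix e) k i)

  det-matrix-cong : ∀ {e f} → e ≋ f → det (matrix e) ≡ det (matrix f)
  det-matrix-cong {e} {f} e≋f = det-cong {N} {matrix e} {matrix f} λ i k → trans (sym (matrix-column e k i))
      (trans (at e≋f _ i) (matrix-column f k i))

  det-matrix-1 : det (matrix (con 1ℤ)) ≡ 1ℤ
  det-matrix-1 = trans (det-cong {N} {matrix (con 1ℤ)} {identity} λ i k → ℤ.*-identityˡ (identity i k))
      (det-identity {N})

-- The signless Laplacian of a rooted product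

-- The indicator of a decidable proposition.
[_] : ∀ {P : Set} → Dec P → ℤ
[ P? ] = if does P? then 1ℤ else 0ℤ

[]-yes : ∀ {P : Set} (P? : Dec P) → P → [ P? ] ≡ 1ℤ
[]-yes P? p rewrite dec-true P? p = refl

[]-no : ∀ {P : Set} (P? : Dec P) → ¬ P → [ P? ] ≡ 0ℤ
[]-no P? ¬p rewrite dec-false P? ¬p = refl

[]-× : ∀ {P Q : Set} (P? : Dec P) (Q? : Dec Q) → [ P? ×-dec Q? ] ≡ [ P? ] * [ Q? ]
[]-× P? Q? with does P? | does Q?
... | true  | true  = refl
... | true  | false = refl
... | false | true  = refl
... | false | false = refl

[]-⊎ : ∀ {P Q : Set} (P? : Dec P) (Q? : Dec Q) → (P → ¬ Q) → [ P? ⊎-dec Q? ] ≡ [ P? ] + [ Q? ]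
[]-⊎ (yes p) Q? ¬pq rewrite dec-false Q? (¬pq p) = refl
[]-⊎ (no _)  Q? ¬pq = sym (ℤ.+-identityˡ _)

[]-cong : ∀ {P Q : Set} (P? : Dec P) (Q? : Dec Q) → (P → Q) → (Q → P) → [ P? ] ≡ [ Q? ]
[]-cong (yes p) Q? f g = sym ([]-yes Q? (f p))
[]-cong (no ¬p) Q? f g = sym ([]-no Q? (¬p ∘ g))

count-tabulate : ∀ {A : Set} {P : A → Set} (P? : ∀ a → Dec (P a)) {n} (f : Fin n → A) → ℤ.+ count P?
    (tabulate f) ≡ sum (λ i → [ P? (f i) ])
count-tabulate P? {zero}  f = refl
count-tabulate P? {suc n} f with does (P? (f zero))
... | true  = cong (λ z → 1ℤ + z) (count-tabulate P? (f ∘ suc))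
... | false = trans (count-tabulate P? (f ∘ suc)) (sym (ℤ.+-identityˡ _))

module _ {n} (G : Graph n) where

  -- Each edge at i contributes the sum of the values at its ends.
  Q-· : ∀ v i → (signlessLaplacian G · v) i ≡ sum (λ j → adjacencyMatrix G i j * (v j + v i))
  Q-· v i = begin
    sum (λ j → (adjacencyMatrix G i j + degreeMatrix G i j) * v j)
      ≡⟨ sum-cong-≗ (λ j → ℤ.*-distribʳ-+ (v j) (adjacencyMatrix G i j) (degreeMatrix G i j)) ⟩
    sum (λ j → adjacencyMatrix G i j * v j + degreeMatrix G i j * v j)
      ≡⟨ ∑-distrib-+ (λ j → adjacencyMatrix G i j * v j) (λ j → degreeMatrix G i j * v j) ⟩
    sum (λ j → adjacencyMatrix G i j * v j) + sum (λ j → degreeMatrix G i j * v j)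
      ≡⟨ cong (λ z → sum (λ j → adjacencyMatrix G i j * v j) + z) degree-part ⟩
    sum (λ j → adjacencyMatrix G i j * v j) + sum (λ j → adjacencyMatrix G i j * v i)
      ≡⟨ ∑-distrib-+ (λ j → adjacencyMatrix G i j * v j) (λ j → adjacencyMatrix G i j * v i) ⟨
    sum (λ j → adjacencyMatrix G i j * v j + adjacencyMatrix G i j * v i)
      ≡⟨ sum-cong-≗ (λ j → sym (ℤ.*-distribˡ-+ (adjacencyMatrix G i j) (v j) (v i))) ⟩
    _ ∎
    where
    off : ∀ j → j ≢ i → degreeMatrix G i j * v j ≡ 0ℤ
    off j j≢i rewrite dec-false (i ≟ j) (j≢i ∘ sym) = ℤ.*-zeroˡ (v j)
    diag : degreeMatrix G i i ≡ ℤ.+ degree G i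
    diag rewrite dec-true (i ≟ i) refl = refl
    degree-part : sum (λ j → degreeMatrix G i j * v j) ≡ sum (λ j → adjacencyMatrix G i j * v i)
    degree-part = begin
      sum (λ j → degreeMatrix G i j * v j)        ≡⟨ sum-single i off ⟩
      degreeMatrix G i i * v i
        ≡⟨ cong (_* v i) (trans diag (count-tabulate (Graph.adj? G i) id)) ⟩
      sum (λ j → adjacencyMatrix G i j) * v i     ≡⟨ *-distribʳ-sum (v i) (λ j → adjacencyMatrix G i j) ⟩
      sum (λ j → adjacencyMatrix G i j * v i)     ∎

module _ {n m} (G : Graph n) (H : Graph m) (r : Fin m) where

  private
    A = adjacencyMatrix G
    B = adjacencyMatrix H

  -- An edge lies either in G, between roots, or in a copy of H; never in both, as
  -- G has no loops.
  adjacency-rootedProduct : ∀ a i b j → adjacencyMatrix (rootedProduct G H r) (combine a i) (combine b j) ≡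
                            identity a r * (identity b r * A i j) + identity i j * B a b
  adjacency-rootedProduct a i b j = trans
      (cong₂ entry (remQuot-combine {m} {n} a i) (remQuot-combine {m} {n} b j))
    (trans ([]-⊎ ((a ≟ r) ×-dec (b ≟ r) ×-dec Graph.adj? G i j) ((i ≟ j) ×-dec Graph.adj? H a b)
             λ (_ , _ , e) (i≡j , _) → Graph.irrefl G i≡j e)
          (cong₂ _+_ (trans ([]-× (a ≟ r) ((b ≟ r) ×-dec Graph.adj? G i j))
              (cong (λ z → identity a r * z) ([]-× (b ≟ r) (Graph.adj? G i j))))
                     ([]-× (i ≟ j) (Graph.adj? H a b))))
    where
    entry : Fin m × Fin n → Fin m × Fin n → ℤ
    entry (a , i) (b , j) = [ ((a ≟ r) ×-dec (b ≟ r) ×-dec Graph.adj? G i j) ⊎-dec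
        ((i ≟ j) ×-dec Graph.adj? H a b) ]

  -- In terms of Kronecker products, with E the matrix unit at the root r:
  -- Q(rootedProduct G H r) = E ⊗ Q(G) + Q(H) ⊗ 1.
  Q-rootedProduct-· : ∀ v a i → (signlessLaplacian (rootedProduct G H r) · v) (combine a i) ≡
    identity a r * (signlessLaplacian G · (λ j → v (combine a j))) i +
        (signlessLaplacian H · (λ b → v (combine b i))) a
  Q-rootedProduct-· v a i = begin
    (signlessLaplacian (rootedProduct G H r) · v) (combine a i)
      ≡⟨ Q-· (rootedProduct G H r) v (combine a i) ⟩
    sum (λ y → adjacencyMatrix (rootedProduct G H r) (combine a i) y * (v y + v (combine a i)))
      ≡⟨ sum-combine m _ ⟩
    sum (λ b → sum (λ j → adjacencyMatrix (rootedProduct G H r) (combine a i) (combine b j) * w b j))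
      ≡⟨ sum-cong-≗
          (λ b → sum-cong-≗ λ j → trans (cong (_* w b j) (adjacency-rootedProduct a i b j))
          (lem (identity a r) (identity b r) (A i j) (identity i j) (B a b) (w b j))) ⟩
    sum (λ b → sum (λ j → identity a r * (identity b r * (A i j * w b j)) + identity i j * (B a b * w b j)))
      ≡⟨ sum-cong-≗
          (λ b → trans
          (∑-distrib-+ (λ j → identity a r * (identity b r * (A i j * w b j)))
          (λ j → identity i j * (B a b * w b j)))
                                 (cong₂ _+_ (sym
                                     (trans (cong (identity a r *_)
                                     (*-distribˡ-sum (identity b r) (λ j → A i j * w b j)))
                                     (*-distribˡ-sum (identity a r) (λ j → identity b r * (A i j * w b j)))))
                                            (identity-· (λ j → B a b * w b j) i))) ⟩
    sum (λ b → identity a r * (identity b r * sum (λ j → A i j * w b j)) + B a b * w b i)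
      ≡⟨ ∑-distrib-+ (λ b → identity a r * (identity b r * sum (λ j → A i j * w b j))) (λ b → B a b * w b i) ⟩
    sum (λ b → identity a r * (identity b r * sum (λ j → A i j * w b j))) + sum (λ b → B a b * w b i)
      ≡⟨ cong₂ _+_ root (sym (Q-· H (λ b → v (combine b i)) a)) ⟩
    _ ∎
    where
    w : Fin m → Fin n → ℤ
    w b j = v (combine b j) + v (combine a i)
    lem : ∀ a b A d B w → (a * (b * A) + d * B) * w ≡ a * (b * (A * w)) + d * (B * w)
    lem = solve-∀
    s : Fin m → ℤ
    s b = sum (λ j → A i j * w b j)
    root : sum (λ b → identity a r * (identity b r * s b)) ≡ identity a r *
        (signlessLaplacian G · (λ j → v (combine a j))) i
    root with a ≟ r
    ... | yes refl = begin
      sum (λ b → 1ℤ * (identity b r * s b))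
        ≡⟨ sum-cong-≗ (λ b → trans (ℤ.*-identityˡ _) (cong (_* s b) (identity-sym b r))) ⟩
      sum (λ b → identity r b * s b)        ≡⟨ identity-· s r ⟩
      s r                                   ≡⟨ Q-· G (λ j → v (combine r j)) i ⟨
      (signlessLaplacian G · (λ j → v (combine r j))) i ≡⟨ ℤ.*-identityˡ _ ⟨
      1ℤ * (signlessLaplacian G · (λ j → v (combine r j))) i ∎
    ... | no _ = trans (sum-zero λ b → ℤ.*-zeroˡ (identity b r * s b))
        (sym (ℤ.*-zeroˡ ((signlessLaplacian G · (λ j → v (combine a j))) i)))

-- The signless Laplacian of a path

sum-at : ∀ {m} (c : ℕ) (f : ℕ → ℤ) → sum {m} (λ b → [ c ℕ.≟ toℕ b ] * f (toℕ b)) ≡ [ c ℕ.<? m ] * f c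
sum-at {m} c f with c ℕ.<? m
... | yes c<m = begin
  sum {m} (λ b → [ c ℕ.≟ toℕ b ] * f (toℕ b))
    ≡⟨ sum-single (fromℕ< c<m)
        (λ b b≢c → trans
        (cong (_* f (toℕ b))
        ([]-no (c ℕ.≟ toℕ b) (λ c≡b → b≢c (toℕ-injective (trans (sym c≡b) (sym (toℕ-fromℕ< c<m)))))))
        (ℤ.*-zeroˡ (f (toℕ b)))) ⟩
  [ c ℕ.≟ toℕ (fromℕ< c<m) ] * f (toℕ (fromℕ< c<m))
    ≡⟨ cong₂ _*_ ([]-yes (c ℕ.≟ toℕ (fromℕ< c<m)) (sym (toℕ-fromℕ< c<m))) (cong f (toℕ-fromℕ< c<m)) ⟩
  1ℤ * f c
    ≡⟨ cong (_* f c) ([]-yes (c ℕ.<? m) c<m) ⟨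
  [ c ℕ.<? m ] * f c ∎
... | no c≮m = trans
    (sum-zero λ b → trans
    (cong (_* f (toℕ b)) ([]-no (c ℕ.≟ toℕ b) λ c≡b → c≮m (subst (ℕ._< m) (sym c≡b) (toℕ<n b))))
    (ℤ.*-zeroˡ (f (toℕ b))))
                     (sym (trans (cong (_* f c) ([]-no (c ℕ.<? m) c≮m)) (ℤ.*-zeroˡ (f c))))

-- The sequence f delayed by one step, starting with 0.
previous : (ℕ → ℤ) → ℕ → ℤ
previous f zero    = 0ℤ
previous f (suc a) = f a

sum-before : ∀ {m} a (f : ℕ → ℤ) → a ℕ.≤ m → sum {m} (λ b → [ suc (toℕ b) ℕ.≟ a ] * f (toℕ b)) ≡ previous f a
sum-before {m} zero    f a≤m = sum-zero {m} λ b → ℤ.*-zeroˡ (f (toℕ b))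
sum-before {m} (suc a) f a<m = begin
  sum {m} (λ b → [ suc (toℕ b) ℕ.≟ suc a ] * f (toℕ b))
    ≡⟨ sum-cong-≗ {m}
        (λ b → cong (_* f (toℕ b))
        ([]-cong (suc (toℕ b) ℕ.≟ suc a) (a ℕ.≟ toℕ b) (λ e → sym (ℕ.suc-injective e))
        (λ e → cong suc (sym e)))) ⟩
  sum {m} (λ b → [ a ℕ.≟ toℕ b ] * f (toℕ b))
    ≡⟨ sum-at {m} a f ⟩
  [ a ℕ.<? m ] * f a
    ≡⟨ trans (cong (_* f a) ([]-yes (a ℕ.<? m) a<m)) (ℤ.*-identityˡ (f a)) ⟩
  f a ∎

-- The two terms are the edges from a to a + 1 and from a - 1 to a.
Q-path-· : ∀ {m} (f : ℕ → ℤ) (a : Fin m) → (signlessLaplacian (path m) · (λ b → f (toℕ b))) a ≡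
  [ suc (toℕ a) ℕ.<? m ] * (f (suc (toℕ a)) + f (toℕ a)) + previous (λ b → f b + f (suc b)) (toℕ a)
Q-path-· {m} f a = begin
  (signlessLaplacian (path m) · (λ b → f (toℕ b))) a
    ≡⟨ Q-· (path m) (λ b → f (toℕ b)) a ⟩
  sum {m} (λ b → [ (suc (toℕ a) ℕ.≟ toℕ b) ⊎-dec (suc (toℕ b) ℕ.≟ toℕ a) ] * g (toℕ b))
    ≡⟨ sum-cong-≗ {m}
        (λ b → trans (cong (_* g (toℕ b)) ([]-⊎ (suc (toℕ a) ℕ.≟ toℕ b) (suc (toℕ b) ℕ.≟ toℕ a) (disjoint b)))
         (ℤ.*-distribʳ-+ (g (toℕ b)) [ suc (toℕ a) ℕ.≟ toℕ b ] [ suc (toℕ b) ℕ.≟ toℕ a ])) ⟩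
  sum {m} (λ b → [ suc (toℕ a) ℕ.≟ toℕ b ] * g (toℕ b) + [ suc (toℕ b) ℕ.≟ toℕ a ] * g (toℕ b))
    ≡⟨ ∑-distrib-+ {m} (λ b → [ suc (toℕ a) ℕ.≟ toℕ b ] * g (toℕ b))
        (λ b → [ suc (toℕ b) ℕ.≟ toℕ a ] * g (toℕ b)) ⟩
  _ ≡⟨ cong₂ _+_ (sum-at {m} (suc (toℕ a)) g)
      (trans (sum-before {m} (toℕ a) g (ℕ.<⇒≤ (toℕ<n a))) (previous-g (toℕ a))) ⟩
  _ ∎
  where
  g : ℕ → ℤ
  g b = f b + f (toℕ a)
  disjoint : ∀ b → suc (toℕ a) ≡ toℕ b → ¬ suc (toℕ b) ≡ toℕ a
  disjoint b p q = ℕ.1+n≰n (ℕ.≤-trans (ℕ.n≤1+n _) (ℕ.≤-reflexive (trans (cong suc p) q)))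
  previous-g : ∀ c → previous (λ b → f b + f c) c ≡ previous (λ b → f b + f (suc b)) c
  previous-g zero    = refl
  previous-g (suc c) = refl

-- Kronecker products of vectors

blockDiagonal-· : ∀ m {n} (B : ℕ → Matrix n n) v (a : Fin m) i →
  (blockDiagonal m B · v) (combine a i) ≡ (B (toℕ a) · (λ j → v (combine a j))) i
blockDiagonal-· m {n} B v a i = begin
  (blockDiagonal m B · v) (vertex a i)
    ≡⟨ sum-combine m (λ y → blockDiagonal m B (vertex a i) y * v y) ⟩
  sum (λ b → sum (λ j → blockDiagonal m B (vertex a i) (vertex b j) * v (vertex b j)))
    ≡⟨ sum-cong-≗
        (λ b → trans
        (sum-cong-≗ λ j → trans (cong (_* v (vertex b j)) (blockDiagonal-combine {m} B a b i j))
        (ℤ.*-assoc (identity a b) (B (toℕ b) i j) (v (vertex b j))))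
                               (sym (*-distribˡ-sum (identity a b) (λ j → B (toℕ b) i j * v (vertex b j))))) ⟩
  sum (λ b → identity a b * (B (toℕ b) · (λ j → v (vertex b j))) i)
    ≡⟨ identity-· (λ b → (B (toℕ b) · (λ j → v (vertex b j))) i) a ⟩
  (B (toℕ a) · (λ j → v (vertex a j))) i ∎
  where
  vertex : Fin m → Fin n → Fin (m ℕ.* n)
  vertex = combine

identity-combine : ∀ {m n} (a b : Fin m) (i j : Fin n) → identity (combine a i)
    (combine b j) ≡ identity a b * identity i j
identity-combine a b i j with a ≟ b | i ≟ j
... | yes refl | yes refl = identity-diag (combine a i)
... | yes refl | no  i≢j  = identity-off (i≢j ∘ proj₂ ∘ combine-injective a i a j)
... | no  a≢b  | _        = trans (identity-off (a≢b ∘ proj₁ ∘ combine-injective a i b j))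
    (sym (ℤ.*-zeroˡ (identity i j)))

-- The Kronecker product of vectors: block a of y ⊗ w is y a times w.
infix 8 _⊗_
_⊗_ : ∀ {m n} → Vector ℤ m → Vector ℤ n → Vector ℤ (m ℕ.* n)
_⊗_ {m} {n} y w x = y (quotient {m} n x) * w (remainder {m} n x)

⊗-combine : ∀ {m n} (y : Vector ℤ m) (w : Vector ℤ n) a i → (y ⊗ w) (combine a i) ≡ y a * w i
⊗-combine {m} {n} y w a i = cong (λ (a , i) → y a * w i) (remQuot-combine {m} {n} a i)

-- The layers of a rooted product with a path

-- The indicator function, on the vertices c = 0, ..., m - 1 of the path, of the
-- vertex at distance k from the free end, c = m - 1 - k.  For k at least m it is 0.
far : ℕ → ℕ → ℕ → ℤ
far m k c = [ c ℕ.+ suc k ℕ.≟ m ]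

far-shift : ∀ m k c → far m k (suc c) ≡ far m (suc k) c
far-shift m k c = cong (λ z → [ z ℕ.≟ m ]) (sym (ℕ.+-suc c (suc k)))

far-zero : ∀ m k c → m < c ℕ.+ suc k → far m k c ≡ 0ℤ
far-zero m k c lt = []-no (c ℕ.+ suc k ℕ.≟ m) λ e → ℕ.<-irrefl (sym e) lt

far-end : ∀ m k → suc k < m → far m k 0 ≡ 0ℤ
far-end m k lt = []-no (suc k ℕ.≟ m) λ e → ℕ.<-irrefl e lt

-- The factor [ suc c ℕ.<? m ] excludes only the free end, where far m (suc k)
-- vanishes.
far-guard : ∀ m k c → c < m → [ suc c ℕ.<? m ] * far m (suc k) c ≡ far m (suc k) c
far-guard m k c c<m with suc c ℕ.<? m
... | yes lt = trans (cong (_* far m (suc k) c) ([]-yes (suc c ℕ.<? m) lt)) (ℤ.*-identityˡ _)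
... | no nlt = trans (cong (_* far m (suc k) c) ([]-no (suc c ℕ.<? m) nlt))
    (trans (ℤ.*-zeroˡ (far m (suc k) c)) (sym (far-zero m (suc k) c
                 (ℕ.≤-trans (s≤s (ℕ.≮⇒≥ nlt))
                     (ℕ.≤-trans (s≤s (s≤s (ℕ.m≤n+m c k))) (ℕ.≤-reflexive (ℕ.+-comm (suc (suc k)) c)))))))

far-guard₀ : ∀ m c → [ suc c ℕ.<? m ] * far m 0 c ≡ 0ℤ
far-guard₀ m c with suc c ℕ.<? m
... | yes lt = trans
    (cong ([ suc c ℕ.<? m ] *_) ([]-no (c ℕ.+ 1 ℕ.≟ m) λ e → ℕ.<-irrefl (trans (ℕ.+-comm 1 c) e) lt))
    (ℤ.*-zeroʳ [ suc c ℕ.<? m ])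
... | no nlt = trans (cong (_* far m 0 c) ([]-no (suc c ℕ.<? m) nlt)) (ℤ.*-zeroˡ (far m 0 c))

far-up : ∀ m k c → c < m → [ suc c ℕ.<? m ] * far m k (suc c) ≡ far m (suc k) c
far-up m k c c<m = trans (cong ([ suc c ℕ.<? m ] *_) (far-shift m k c)) (far-guard m k c c<m)

-- The signless Laplacian of the path applied to far m k, at the vertex c.
pathValue : ℕ → ℕ → ℕ → ℤ
pathValue m k c = [ suc c ℕ.<? m ] * (far m k (suc c) + far m k c) + previous
    (λ b → far m k b + far m k (suc b)) c

path-far : ∀ {m} k (a : Fin m) → (signlessLaplacian (path m) · (λ b → far m k (toℕ b))) a ≡ pathValue m k
    (toℕ a)
path-far {m} k a = Q-path-· {m} (far m k) a

pathValue-first : ∀ m c → 1 < m → c < m → pathValue m 0 c ≡ far m 0 c + far m 1 c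
pathValue-first m c 1<m c<m = begin
  pathValue m 0 c
    ≡⟨ cong₂ _+_ (ℤ.*-distribˡ-+ [ suc c ℕ.<? m ] _ _) (prev c c<m) ⟩
  [ suc c ℕ.<? m ] * far m 0 (suc c) + [ suc c ℕ.<? m ] * far m 0 c + far m 0 c
    ≡⟨ cong₂ (λ x y → x + y + far m 0 c) (far-up m 0 c c<m) (far-guard₀ m c) ⟩
  far m 1 c + 0ℤ + far m 0 c
    ≡⟨ lem (far m 1 c) (far m 0 c) ⟩
  far m 0 c + far m 1 c ∎
  where
  lem : ∀ x y → x + 0ℤ + y ≡ y + x
  lem = solve-∀
  prev : ∀ c → c < m → previous (λ b → far m 0 b + far m 0 (suc b)) c ≡ far m 0 c
  prev zero    _   = sym (far-end m 0 1<m)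
  prev (suc c) c<m = trans
      (cong (_+ far m 0 (suc c)) ([]-no (c ℕ.+ 1 ℕ.≟ m) λ e → ℕ.<-irrefl (trans (ℕ.+-comm 1 c) e) c<m))
      (ℤ.+-identityˡ _)

pathValue-middle : ∀ m k c → suc (suc k) < m → c < m →
                   pathValue m (suc k) c ≡ far m k c + (far m (suc k) c + far m (suc k) c) + far m
                       (suc (suc k)) c
pathValue-middle m k c k+2<m c<m = begin
  pathValue m (suc k) c
    ≡⟨ cong₂ _+_ (ℤ.*-distribˡ-+ [ suc c ℕ.<? m ] _ _) (prev c) ⟩
  [ suc c ℕ.<? m ] * far m (suc k) (suc c) + [ suc c ℕ.<? m ] * far m (suc k) c +
      (far m k c + far m (suc k) c)
    ≡⟨ cong₂ (λ x y → x + y + (far m k c + far m (suc k) c)) (far-up m (suc k) c c<m) (far-guard m k c c<m) ⟩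
  far m (suc (suc k)) c + far m (suc k) c + (far m k c + far m (suc k) c)
    ≡⟨ lem (far m (suc (suc k)) c) (far m (suc k) c) (far m k c) ⟩
  _ ∎
  where
  lem : ∀ x y z → x + y + (z + y) ≡ z + (y + y) + x
  lem = solve-∀
  prev : ∀ c → previous (λ b → far m (suc k) b + far m (suc k) (suc b)) c ≡ far m k c + far m (suc k) c
  prev zero    = sym (cong₂ _+_ (far-end m k (ℕ.<⇒≤ k+2<m)) (far-end m (suc k) k+2<m))
  prev (suc c) = cong (_+ far m (suc k) (suc c)) (sym (far-shift m k c))

pathValue-last : ∀ k c → let m = suc (suc k) in c < m → pathValue m (suc k) c ≡ far m k c + far m (suc k) c
pathValue-last k c c<m = begin
  pathValue m (suc k) c
    ≡⟨ cong₂ _+_ (ℤ.*-distribˡ-+ [ suc c ℕ.<? m ] _ _) (prev c) ⟩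
  [ suc c ℕ.<? m ] * far m (suc k) (suc c) + [ suc c ℕ.<? m ] * far m (suc k) c + far m k c
    ≡⟨ cong₂ (λ x y → x + y + far m k c)
        (trans (far-up m (suc k) c c<m) (far-zero m (suc (suc k)) c (ℕ.m≤n+m (suc m) c)))
        (far-guard m k c c<m) ⟩
  0ℤ + far m (suc k) c + far m k c
    ≡⟨ lem (far m (suc k) c) (far m k c) ⟩
  far m k c + far m (suc k) c ∎
  where
  m = suc (suc k)
  lem : ∀ x y → 0ℤ + x + y ≡ y + x
  lem = solve-∀
  prev : ∀ c → previous (λ b → far m (suc k) b + far m (suc k) (suc b)) c ≡ far m k c
  prev zero    = sym (far-end m k ℕ.≤-refl)
  prev (suc c) = trans (cong₂ _+_ (sym (far-shift m k c)) (far-zero m (suc k) (suc c) (s≤s (ℕ.m≤n+m m c))))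
      (ℤ.+-identityʳ _)

-- The rooted product of G with the path on m = k + 2 vertices, rooted at the end
-- vertex 0.
module Setup {n} (G : Graph n) (k : ℕ) where

  m : ℕ
  m = suc (suc k)

  Q : Matrix n n
  Q = signlessLaplacian G

  𝑇 𝑋 : Matrix (m ℕ.* n) (m ℕ.* n)
  𝑇 = signlessLaplacian (rootedProduct G (path m) zero)
  𝑋 = blockDiagonal m (λ _ → Q)

  vertex : Fin m → Fin n → Fin (m ℕ.* n)
  vertex = combine

  𝑇-combine : ∀ v a i → (𝑇 · v) (vertex a i) ≡
    identity a zero * (Q · (λ j → v (vertex a j))) i + (signlessLaplacian (path m) · (λ b → v (vertex b i))) a
  𝑇-combine = Q-rootedProduct-· G (path m) zero

  𝑋-combine : ∀ v (a : Fin m) i → (𝑋 · v) (vertex a i) ≡ (Q · (λ j → v (vertex a j))) i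
  𝑋-combine = blockDiagonal-· m (λ _ → Q)

  𝑇𝑋-comm : ∀ v → 𝑇 · 𝑋 · v ≗ 𝑋 · 𝑇 · v
  𝑇𝑋-comm v = combine-ind {m} {n} (λ x → (𝑇 · 𝑋 · v) x ≡ (𝑋 · 𝑇 · v) x) λ a i → begin
    (𝑇 · 𝑋 · v) (vertex a i)
      ≡⟨ 𝑇-combine (𝑋 · v) a i ⟩
    identity a zero * (Q · (λ j → (𝑋 · v) (vertex a j))) i + (L · (λ b → (𝑋 · v) (vertex b i))) a
      ≡⟨ cong₂ (λ x y → identity a zero * x + y) (·-cong Q (λ j → 𝑋-combine v a j) i)
          (·-cong L (λ b → 𝑋-combine v b i) a) ⟩
    identity a zero * (Q · Q · (λ j → v (vertex a j))) i + (L · (λ b → (Q · (λ j → v (vertex b j))) i)) a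
      ≡⟨ cong (λ z → identity a zero * (Q · Q · (λ j → v (vertex a j))) i + z) (swap a i) ⟩
    identity a zero * (Q · Q · (λ j → v (vertex a j))) i + (Q · (λ j → (L · (λ b → v (vertex b j))) a)) i
      ≡⟨ ·-linear Q (identity a zero) (Q · (λ j → v (vertex a j))) (λ j → (L · (λ b → v (vertex b j))) a) i ⟨
    (Q · (λ j → identity a zero * (Q · (λ j → v (vertex a j))) j + (L · (λ b → v (vertex b j))) a)) i
      ≡⟨ ·-cong Q (λ j → sym (𝑇-combine v a j)) i ⟩
    (Q · (λ j → (𝑇 · v) (vertex a j))) i
      ≡⟨ 𝑋-combine (𝑇 · v) a i ⟨
    (𝑋 · 𝑇 · v) (vertex a i) ∎
    where
    L : Matrix m m
    L = signlessLaplacian (path m)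
    swap : ∀ a i → (L · (λ b → (Q · (λ j → v (vertex b j))) i)) a ≡
        (Q · (λ j → (L · (λ b → v (vertex b j))) a)) i
    swap a i = begin
      sum (λ b → L a b * sum (λ j → Q i j * v (vertex b j)))
        ≡⟨ sum-cong-≗ (λ b → *-distribˡ-sum (L a b) (λ j → Q i j * v (vertex b j))) ⟩
      sum (λ b → sum (λ j → L a b * (Q i j * v (vertex b j))))
        ≡⟨ ∑-comm (λ b j → L a b * (Q i j * v (vertex b j))) ⟩
      sum (λ j → sum (λ b → L a b * (Q i j * v (vertex b j))))
        ≡⟨ sum-cong-≗
            (λ j → trans (sum-cong-≗ λ b → lem (L a b) (Q i j) (v (vertex b j)))
            (sym (*-distribˡ-sum (Q i j) (λ b → L a b * v (vertex b j))))) ⟩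
      sum (λ j → Q i j * sum (λ b → L a b * v (vertex b j))) ∎
      where
      lem : ∀ a b c → a * (b * c) ≡ b * (a * c)
      lem = solve-∀

  open Operators 𝑇 𝑋 𝑇𝑋-comm public
  open Polynomials commutativeRing constants 𝕥 public

  -- The vector w placed at distance l from the free end of the path.
  layer : ℕ → Vector ℤ n → Vector ℤ (m ℕ.* n)
  layer l w = (λ (a : Fin m) → far m l (toℕ a)) ⊗ w

  layer-combine : ∀ l w (a : Fin m) i → layer l w (vertex a i) ≡ far m l (toℕ a) * w i
  layer-combine l w = ⊗-combine (λ a → far m l (toℕ a)) w

  layer-cong : ∀ l {v w} → v ≗ w → layer l v ≗ layer l w
  layer-cong l v≗w x = cong (far m l (toℕ (quotient {m} n x)) *_) (v≗w (remainder {m} n x))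

  𝑋-layer : ∀ l w → 𝑋 · layer l w ≗ layer l (Q · w)
  𝑋-layer l w = combine-ind {m} {n} (λ x → (𝑋 · layer l w) x ≡ layer l (Q · w) x) λ a i → begin
    (𝑋 · layer l w) (vertex a i)                      ≡⟨ 𝑋-combine (layer l w) a i ⟩
    (Q · (λ j → layer l w (vertex a j))) i            ≡⟨ ·-cong Q (layer-combine l w a) i ⟩
    (Q · (λ j → far m l (toℕ a) * w j)) i              ≡⟨ ·-* Q (far m l (toℕ a)) w i ⟩
    far m l (toℕ a) * (Q · w) i                        ≡⟨ layer-combine l (Q · w) a i ⟨
    layer l (Q · w) (vertex a i)                      ∎

  𝑇-layer : ∀ l w (a : Fin m) i → (𝑇 · layer l w) (vertex a i) ≡
            identity a zero * far m l (toℕ a) * (Q · w) i + pathValue m l (toℕ a) * w i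
  𝑇-layer l w a i = begin
    (𝑇 · layer l w) (vertex a i)
      ≡⟨ 𝑇-combine (layer l w) a i ⟩
    identity a zero * (Q · (λ j → layer l w (vertex a j))) i +
        (signlessLaplacian (path m) · (λ b → layer l w (vertex b i))) a
      ≡⟨ cong₂ (λ x y → identity a zero * x + y)
           (trans (·-cong Q (layer-combine l w a) i) (·-* Q (far m l (toℕ a)) w i))
           (trans (·-cong (signlessLaplacian (path m))
               (λ b → trans (layer-combine l w b i) (ℤ.*-comm (far m l (toℕ b)) (w i))) a)
                  (·-* (signlessLaplacian (path m)) (w i) (λ b → far m l (toℕ b)) a)) ⟩
    identity a zero * (far m l (toℕ a) * (Q · w) i) + w i *
        (signlessLaplacian (path m) · (λ b → far m l (toℕ b))) a
      ≡⟨ cong₂ _+_ (sym (ℤ.*-assoc (identity a zero) (far m l (toℕ a)) ((Q · w) i)))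
          (trans (ℤ.*-comm (w i) _) (cong (_* w i) (path-far l a))) ⟩
    _ ∎

  -- Only the layer of the root, l = k + 1, has an entry at the root.
  root-zero : ∀ l (a : Fin m) → suc l < m → identity a zero * far m l (toℕ a) ≡ 0ℤ
  root-zero l zero    lt = cong (1ℤ *_) (far-end m l lt)
  root-zero l (suc a) lt = ℤ.*-zeroˡ (far m l (toℕ (suc a)))

  root-last : ∀ (a : Fin m) → identity a zero * far m (suc k) (toℕ a) ≡ far m (suc k) (toℕ a)
  root-last zero    = ℤ.*-identityˡ (far m (suc k) 0)
  root-last (suc a) = trans (ℤ.*-zeroˡ (far m (suc k) (toℕ (suc a))))
      (sym (far-zero m (suc k) (suc (toℕ a)) (s≤s (ℕ.m≤n+m m (toℕ a)))))

  𝑇-layer-inner : ∀ l w (a : Fin m) i → suc l < m → (𝑇 · layer l w) (vertex a i) ≡ pathValue m l (toℕ a) * w i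
  𝑇-layer-inner l w a i lt = trans (𝑇-layer l w a i)
      (trans (cong (λ z → z * (Q · w) i + pathValue m l (toℕ a) * w i) (root-zero l a lt))
      (lem ((Q · w) i) _))
    where
    lem : ∀ x y → 0ℤ * x + y ≡ y
    lem = solve-∀

  𝑇-layer-first : ∀ w → 𝑇 · layer 0 w ≗ λ x → layer 0 w x + layer 1 w x
  𝑇-layer-first w = combine-ind {m} {n} (λ x → (𝑇 · layer 0 w) x ≡ layer 0 w x + layer 1 w x) λ a i → begin
    (𝑇 · layer 0 w) (vertex a i)                               ≡⟨ 𝑇-layer-inner 0 w a i (s≤s (s≤s z≤n)) ⟩
    pathValue m 0 (toℕ a) * w i
      ≡⟨ cong (_* w i) (pathValue-first m (toℕ a) (s≤s (s≤s z≤n)) (toℕ<n a)) ⟩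
    (far m 0 (toℕ a) + far m 1 (toℕ a)) * w i
      ≡⟨ ℤ.*-distribʳ-+ (w i) (far m 0 (toℕ a)) (far m 1 (toℕ a)) ⟩
    far m 0 (toℕ a) * w i + far m 1 (toℕ a) * w i
      ≡⟨ cong₂ _+_ (layer-combine 0 w a i) (layer-combine 1 w a i) ⟨
    layer 0 w (vertex a i) + layer 1 w (vertex a i)           ∎

  𝑇-layer-middle : ∀ l w → suc (suc l) < m →
    𝑇 · layer (suc l) w ≗ λ x → layer l w x + (layer (suc l) w x + layer (suc l) w x) + layer
        (suc (suc l)) w x
  𝑇-layer-middle l w lt = combine-ind {m} {n}
      (λ x → (𝑇 · layer (suc l) w) x ≡ layer l w x + (layer (suc l) w x + layer (suc l) w x) + layer
      (suc (suc l)) w x) λ a i → begin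
    (𝑇 · layer (suc l) w) (vertex a i)                         ≡⟨ 𝑇-layer-inner (suc l) w a i lt ⟩
    pathValue m (suc l) (toℕ a) * w i
      ≡⟨ cong (_* w i) (pathValue-middle m l (toℕ a) lt (toℕ<n a)) ⟩
    (far m l (toℕ a) + (far m (suc l) (toℕ a) + far m (suc l) (toℕ a)) + far m (suc (suc l)) (toℕ a)) * w i
      ≡⟨ lem (far m l (toℕ a)) (far m (suc l) (toℕ a)) (far m (suc (suc l)) (toℕ a)) (w i) ⟩
    far m l (toℕ a) * w i + (far m (suc l) (toℕ a) * w i + far m (suc l) (toℕ a) * w i) + far m (suc (suc l))
        (toℕ a) * w i
      ≡⟨ cong₂ _+_ (cong₂ (λ y z → y + (z + z)) (layer-combine l w a i) (layer-combine (suc l) w a i))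
          (layer-combine (suc (suc l)) w a i) ⟨
    _ ∎
    where
    lem : ∀ x y z w → (x + (y + y) + z) * w ≡ x * w + (y * w + y * w) + z * w
    lem = solve-∀

  𝑇-layer-last : ∀ w → 𝑇 · layer (suc k) w ≗ λ x → layer (suc k) (Q · w) x + (layer k w x + layer (suc k) w x)
  𝑇-layer-last w = combine-ind {m} {n}
      (λ x → (𝑇 · layer (suc k) w) x ≡ layer (suc k) (Q · w) x + (layer k w x + layer (suc k) w x)) λ a i →
      begin
    (𝑇 · layer (suc k) w) (vertex a i)
      ≡⟨ 𝑇-layer (suc k) w a i ⟩
    identity a zero * far m (suc k) (toℕ a) * (Q · w) i + pathValue m (suc k) (toℕ a) * w i
      ≡⟨ cong₂ (λ x y → x * (Q · w) i + y * w i) (root-last a) (pathValue-last k (toℕ a) (toℕ<n a)) ⟩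
    far m (suc k) (toℕ a) * (Q · w) i + (far m k (toℕ a) + far m (suc k) (toℕ a)) * w i
      ≡⟨ cong₂ _+_ (sym (layer-combine (suc k) (Q · w) a i))
          (trans (ℤ.*-distribʳ-+ (w i) (far m k (toℕ a)) (far m (suc k) (toℕ a)))
           (sym (cong₂ _+_ (layer-combine k w a i) (layer-combine (suc k) w a i)))) ⟩
    _ ∎

  -- The polynomials ψ l move a vector from the free end along the path: they satisfy
  -- the same three-term recurrence as the layers.
  ψ-layer : ∀ l w → l < m → ⟦ ψ l ⟧ (layer 0 w) ≗ layer l w
  ψ-layer zero w _ x = ℤ.*-identityˡ (layer 0 w x)
  ψ-layer (suc zero) w _ x = trans (cong (_+ -1ℤ * (1ℤ * layer 0 w x)) (𝑇-layer-first w x))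
      (lem (layer 0 w x) (layer 1 w x))
    where
    lem : ∀ x y → x + y + -1ℤ * (1ℤ * x) ≡ y
    lem = solve-∀
  ψ-layer (suc (suc l)) w lt x = begin
    (𝑇 · ⟦ ψ (suc l) ⟧ (layer 0 w)) x + -1ℤ *
        (⟦ ψ (suc l) ⟧ (layer 0 w) x + ⟦ ψ (suc l) ⟧ (layer 0 w) x) + -1ℤ * ⟦ ψ l ⟧ (layer 0 w) x
      ≡⟨ cong₂ _+_
          (cong₂ (λ y z → y + -1ℤ * (z + z))
          (trans (·-cong 𝑇 (ψ-layer (suc l) w (ℕ.<⇒≤ lt)) x) (𝑇-layer-middle l w lt x))
          (ψ-layer (suc l) w (ℕ.<⇒≤ lt) x))
                   (cong (-1ℤ *_) (ψ-layer l w (ℕ.<⇒≤ (ℕ.<⇒≤ lt)) x)) ⟩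
    layer l w x + (layer (suc l) w x + layer (suc l) w x) + layer (suc (suc l)) w x + -1ℤ *
        (layer (suc l) w x + layer (suc l) w x) + -1ℤ * layer l w x
      ≡⟨ lem (layer l w x) (layer (suc l) w x) (layer (suc (suc l)) w x) ⟩
    layer (suc (suc l)) w x ∎
    where
    lem : ∀ x y z → x + (y + y) + z + -1ℤ * (y + y) + -1ℤ * x ≡ z
    lem = solve-∀

  φ-layer : ∀ w → ⟦ φ k ⟧ (layer 0 w) ≗ layer (suc k) (Q · w)
  φ-layer w x = begin
    (𝑇 · ⟦ ψ (suc k) ⟧ (layer 0 w)) x + -1ℤ * ⟦ ψ (suc k) ⟧ (layer 0 w) x + -1ℤ * ⟦ ψ k ⟧ (layer 0 w) x
      ≡⟨ cong₂ _+_
          (cong₂ (λ y z → y + -1ℤ * z) (trans (·-cong 𝑇 (ψ-layer (suc k) w ℕ.≤-refl) x) (𝑇-layer-last w x))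
          (ψ-layer (suc k) w ℕ.≤-refl x))
                   (cong (-1ℤ *_) (ψ-layer k w (ℕ.n≤1+n _) x)) ⟩
    layer (suc k) (Q · w) x + (layer k w x + layer (suc k) w x) + -1ℤ * layer (suc k) w x + -1ℤ * layer k w x
      ≡⟨ lem (layer (suc k) (Q · w) x) (layer k w x) (layer (suc k) w x) ⟩
    layer (suc k) (Q · w) x ∎
    where
    lem : ∀ x y z → x + (y + z) + -1ℤ * z + -1ℤ * y ≡ x
    lem = solve-∀

  far-opposite : ∀ (a b : Fin m) → far m (toℕ (opposite a)) (toℕ b) ≡ identity b a
  far-opposite a b = []-cong (toℕ b ℕ.+ suc (toℕ (opposite a)) ℕ.≟ m) (b ≟ a)
    (λ e → toℕ-injective (ℕ.+-cancelʳ-≡ (suc (toℕ (opposite a))) (toℕ b) (toℕ a) (trans e (sym total))))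
    λ { refl → total }
    where
    total : toℕ a ℕ.+ suc (toℕ (opposite a)) ≡ m
    total = trans (ℕ.+-suc (toℕ a) _)
        (trans (cong (λ z → suc (toℕ a) ℕ.+ z) (opposite-prop a)) (ℕ.m+[n∸m]≡n (toℕ<n a)))

  basis-layer : ∀ (a : Fin m) i → layer (toℕ (opposite a)) (λ j → identity j i) ≗ λ x → identity x
      (vertex a i)
  basis-layer a i = combine-ind {m} {n}
      (λ x → layer (toℕ (opposite a)) (λ j → identity j i) x ≡ identity x (vertex a i)) λ b j →
    trans (layer-combine (toℕ (opposite a)) (λ j → identity j i) b j)
          (trans (cong (_* identity j i) (far-opposite a b)) (sym (identity-combine b a j i)))

  -- The vectors of layer 0 generate all others, by ψ-layer, so an element of the
  -- commutative ring is determined by its action on layer 0.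
  layer₀-cyclic : ∀ {e f} → (∀ w → ⟦ e ⟧ (layer 0 w) ≗ ⟦ f ⟧ (layer 0 w)) → e ≋ f
  layer₀-cyclic {e} {f} e≗f = equal λ v x →
    trans (matrix-· e v x) (trans (sum-cong-≗ λ y → cong (_* v y) (entry x y)) (sym (matrix-· f v x)))
    where
    module _ (a : Fin m) (i : Fin n) where
      p : Expr
      p = ψ (toℕ (opposite a))
      δ : Vector ℤ n
      δ j = identity j i
      column : ∀ e → (λ x → matrix e x (vertex a i)) ≗ ⟦ p ⟧ (⟦ e ⟧ (layer 0 δ))
      column e x = begin
        matrix e x (vertex a i)                     ≡⟨ matrix-column e (vertex a i) x ⟨
        ⟦ e ⟧ (λ x → identity x (vertex a i)) x
          ≡⟨ ⟦⟧-cong e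
              (λ y → sym (trans (ψ-layer (toℕ (opposite a)) δ (toℕ<n (opposite a)) y)
              (basis-layer a i y))) x ⟩
        ⟦ e ⟧ (⟦ p ⟧ (layer 0 δ)) x                  ≡⟨ ⟦⟧-comm e p (layer 0 δ) x ⟩
        ⟦ p ⟧ (⟦ e ⟧ (layer 0 δ)) x                  ∎
    entry : ∀ x y → matrix e x y ≡ matrix f x y
    entry x = combine-ind {m} {n} (λ y → matrix e x y ≡ matrix f x y) λ a i →
      trans (column a i e x) (trans (⟦⟧-cong (p a i) (e≗f (δ a i)) x) (sym (column a i f x)))

  φ≋xψ : φ k ≋ 𝕩 ⊠ ψ (suc k)
  φ≋xψ = layer₀-cyclic λ w x → trans (φ-layer w x)
    (sym (trans (·-cong 𝑋 (ψ-layer (suc k) w ℕ.≤-refl) x) (𝑋-layer (suc k) w x)))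

  open Relation k 𝕩 φ≋xψ public hiding (m)

-- Spliced sequences and closure properties of column spaces

-- The first e terms of f, followed by the terms of g.
splice : ∀ {A : Set} → ℕ → (ℕ → A) → (ℕ → A) → ℕ → A
splice zero    f g c       = g c
splice (suc e) f g zero    = f 0
splice (suc e) f g (suc c) = splice e (f ∘ suc) g c

splice-< : ∀ {A : Set} {e} (f g : ℕ → A) {i} → i < e → splice e f g i ≡ f i
splice-< {e = suc e} f g {zero}  _         = refl
splice-< {e = suc e} f g {suc i} (s≤s i<e) = splice-< (f ∘ suc) g i<e

splice-+ : ∀ {A : Set} e (f g : ℕ → A) j → splice e f g (e ℕ.+ j) ≡ g j
splice-+ zero    f g j = refl
splice-+ (suc e) f g j = splice-+ e (f ∘ suc) g j

splice-all : ∀ {A : Set} (P : A → Set) e {d} {f g : ℕ → A} → (∀ i → i < e → P (f i)) →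
    (∀ j → j < d → P (g j)) →
             ∀ c → c < e ℕ.+ d → P (splice e f g c)
splice-all P zero    Pf Pg c       c<     = Pg c c<
splice-all P (suc e) Pf Pg zero    _      = Pf 0 (s≤s z≤n)
splice-all P (suc e) Pf Pg (suc c) (s≤s c<) = splice-all P e (λ i i<e → Pf (suc i) (s≤s i<e)) Pg c c<

det-blocks-const : ∀ {n} m (A : Matrix n n) → det-blocks m (λ _ → A) ≡ det A ^ m
det-blocks-const zero    A = refl
det-blocks-const (suc m) A = cong (det A *_) (det-blocks-const m A)

det-blocks-splice : ∀ {n} e d (A : Matrix n n) → det-blocks (e ℕ.+ d)
    (splice e (λ _ → identity) (λ _ → A)) ≡ det A ^ d
det-blocks-splice zero        d A = det-blocks-const d A
det-blocks-splice {n} (suc e) d A = trans (cong₂ _*_ (det-identity {n}) (det-blocks-splice e d A))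
    (ℤ.*-identityˡ _)

module _ {M N} (A : Matrix M N) where

  ∈col-resp : ∀ {v w} → v ≗ w → v ∈col A → w ∈col A
  ∈col-resp v≗w (c , eq) = c , λ x → trans (sym (v≗w x)) (eq x)

  ∈col-column : ∀ k → (λ x → A x k) ∈col A
  ∈col-column k = (λ j → identity j k) , λ x → sym (·-identity A k x)

  ∈col-+ : ∀ {v w} → v ∈col A → w ∈col A → (λ x → v x + w x) ∈col A
  ∈col-+ (c , p) (d , q) = (λ j → c j + d j) , λ x → trans (cong₂ _+_ (p x) (q x)) (sym (·-+ A c d x))

  ∈col-* : ∀ s {v} → v ∈col A → (λ x → s * v x) ∈col A
  ∈col-* s (c , p) = (λ j → s * c j) , λ x → trans (cong (s *_) (p x)) (sym (·-* A s c x))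

  ∈col-0 : ∀ {v} → v ≗ (λ _ → 0ℤ) → v ∈col A
  ∈col-0 z = (λ _ → 0ℤ) , λ x → trans (z x) (sym (sum-zero λ j → ℤ.*-zeroʳ (A x j)))

∈col-∙ : ∀ {L M N} (B : Matrix L M) (A : Matrix M N) {v} → v ∈col A → (B · v) ∈col (B ∙ A)
∈col-∙ B A (c , p) = c , λ x → trans (·-cong B p x) (sym (∙-· B A c x))

-- The determinant of the walk matrix

module Main {n} (G : Graph n) (k : ℕ) where
  open Setup G k
  open Algebra.Properties.Semiring.Exp (CommutativeRing.semiring commutativeRing) using () renaming
      (_^_ to _↑_)
  private
    module R = CommutativeRing commutativeRing

  N : ℕ
  N = m ℕ.* n

  col-isSubgroup : ∀ (A : Matrix N N) (v : Vector ℤ N) → IsSubgroup (λ f → ⟦ f ⟧ v ∈col A)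
  col-isSubgroup A v = record
    { resp  = λ f≋g → ∈col-resp A (at f≋g v)
    ; zero∈ = ∈col-0 A λ x → ℤ.*-zeroˡ (v x)
    ; add∈  = ∈col-+ A
    ; neg∈  = ∈col-* A -1ℤ
    }

  -- The unit vectors.
  δ : Fin n → Vector ℤ n
  δ i j = identity j i

  -- The embedding of vectors into layer 0.
  U : Matrix N n
  U x i = layer 0 (δ i) x

  U-· : ∀ w → U · w ≗ layer 0 w
  U-· w x = trans (sum-cong-≗ λ i → ℤ.*-assoc s (identity (remainder {m} n x) i) (w i))
    (trans (sym (*-distribˡ-sum s (λ i → identity (remainder {m} n x) i * w i)))
        (cong (s *_) (identity-· w (remainder {m} n x))))
    where
    s : ℤ
    s = far m 0 (toℕ (quotient {m} n x))

  -- The matrix whose columns in block a are the images under fs a of the unit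
  -- vectors of layer 0.
  family : (Fin m → Expr) → Matrix N N
  family fs x y = ⟦ fs (quotient {m} n y) ⟧ (layer 0 (δ (remainder {m} n y))) x

  -- The vector w placed in block a, that is, at the vertex a of the path.
  inBlock : Fin m → Vector ℤ n → Vector ℤ N
  inBlock a w = (λ (b : Fin m) → identity b a) ⊗ w

  family-· : ∀ fs (a : Fin m) w → ⟦ fs a ⟧ (layer 0 w) ≗ family fs · inBlock a w
  family-· fs a w x = sym (begin
    (family fs · inBlock a w) x
      ≡⟨ sum-combine m {n} (λ y → family fs x y * inBlock a w y) ⟩
    sum (λ b → sum (λ i → family fs x (vertex b i) * inBlock a w (vertex b i)))
      ≡⟨ sum-cong-≗
          (λ b → trans (sum-cong-≗ λ i → entry b i)
          (sym (*-distribˡ-sum (identity a b) (λ i → ⟦ fs b ⟧ (layer 0 (δ i)) x * w i)))) ⟩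
    sum (λ b → identity a b * sum (λ i → ⟦ fs b ⟧ (layer 0 (δ i)) x * w i))
      ≡⟨ identity-· (λ b → sum (λ i → ⟦ fs b ⟧ (layer 0 (δ i)) x * w i)) a ⟩
    sum (λ i → ⟦ fs a ⟧ (layer 0 (δ i)) x * w i)
      ≡⟨ sum-cong-≗ (λ i → cong (_* w i) (matrix-· (fs a) (layer 0 (δ i)) x)) ⟩
    ((matrix (fs a) ∙ U) · w) x
      ≡⟨ ∙-· (matrix (fs a)) U w x ⟩
    (matrix (fs a) · U · w) x
      ≡⟨ ·-cong (matrix (fs a)) (U-· w) x ⟩
    (matrix (fs a) · layer 0 w) x
      ≡⟨ matrix-· (fs a) (layer 0 w) x ⟨
    ⟦ fs a ⟧ (layer 0 w) x ∎)
    where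
    entry : ∀ b i → family fs x (vertex b i) * inBlock a w (vertex b i) ≡ identity a b *
        (⟦ fs b ⟧ (layer 0 (δ i)) x * w i)
    entry b i = begin
      family fs x (vertex b i) * inBlock a w (vertex b i)
        ≡⟨ cong₂ _*_ (cong (λ (b , i) → ⟦ fs b ⟧ (layer 0 (δ i)) x) (remQuot-combine {m} {n} b i))
                     (trans (⊗-combine (λ b → identity b a) w b i) (cong (_* w i) (identity-sym b a))) ⟩
      ⟦ fs b ⟧ (layer 0 (δ i)) x * (identity a b * w i)
        ≡⟨ lem (⟦ fs b ⟧ (layer 0 (δ i)) x) (identity a b) (w i) ⟩
      identity a b * (⟦ fs b ⟧ (layer 0 (δ i)) x * w i) ∎
      where
      lem : ∀ a b c → a * (b * c) ≡ b * (a * c)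
      lem a b c = trans (sym (ℤ.*-assoc a b c)) (trans (cong (_* c) (ℤ.*-comm a b)) (ℤ.*-assoc b a c))

  -- The ring elements that map layer 0 into the span of the columns of the family.
  -- They contain the family and form a subgroup stable under 𝕩; so the family may
  -- be regarded as a generating family over the polynomials in 𝕩.
  Generated : (Fin m → Expr) → Expr → Set
  Generated fs f = ∀ w → ⟦ f ⟧ (layer 0 w) ∈col family fs

  generated-isSubgroup : ∀ fs → IsSubgroup (Generated fs)
  generated-isSubgroup fs = record
    { resp  = λ f≋g p w → resp (col-isSubgroup (family fs) (layer 0 w)) f≋g (p w)
    ; zero∈ = λ w → zero∈ (col-isSubgroup (family fs) (layer 0 w))
    ; add∈  = λ p q w → ∈col-+ (family fs) (p w) (q w)
    ; neg∈  = λ p w → ∈col-* (family fs) -1ℤ (p w)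
    }
    where open IsSubgroup

  𝕩-shift : ∀ f w → ⟦ 𝕩 ⊠ f ⟧ (layer 0 w) ≗ ⟦ f ⟧ (layer 0 (Q · w))
  𝕩-shift f w x = trans (⟦⟧-comm 𝕩 f (layer 0 w) x) (⟦⟧-cong f (𝑋-layer 0 w) x)

  generated-𝕩 : ∀ fs {f} → Generated fs f → Generated fs (𝕩 ⊠ f)
  generated-𝕩 fs {f} p w = ∈col-resp (family fs) (λ x → sym (𝕩-shift f w x)) (p (Q · w))

  generated-member : ∀ fs a → Generated fs (fs a)
  generated-member fs a w = inBlock a w , family-· fs a w

  family-∣ : ∀ {fs gs} → (∀ a → Generated gs (fs a)) → det (family gs) ∣ det (family fs)
  family-∣ {fs} {gs} p = det-∣-det {A = family gs} {family fs} λ y → p (quotient {m} n y)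
      (δ (remainder {m} n y))

  -- The family ψ (m - 1 - a), which moves layer 0 to block a; its matrix is the
  -- identity.
  standard : Fin m → Expr
  standard a = ψ (toℕ (opposite a))

  standard-degree : ∀ a → Deg m (standard a)
  standard-degree a = deg-mono (toℕ<n (opposite a)) (monic⇒deg (monic-ψ (toℕ (opposite a))))

  standard-column : ∀ (a : Fin m) i → ⟦ standard a ⟧ (layer 0 (δ i)) ≗ λ x → identity x (vertex a i)
  standard-column a i x = trans (ψ-layer (toℕ (opposite a)) (δ i) (toℕ<n (opposite a)) x) (basis-layer a i x)

  family-standard : ∀ f → det (family (λ a → f ⊠ standard a)) ≡ det (matrix f)
  family-standard f = det-cong {N} {family (λ a → f ⊠ standard a)} {matrix f} λ x →
    combine-ind {m} {n} (λ y → family (λ a → f ⊠ standard a) x y ≡ matrix f x y) λ a i →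
      trans (cong (λ (a , i) → ⟦ f ⟧ (⟦ standard a ⟧ (layer 0 (δ i))) x) (remQuot-combine {m} {n} a i))
            (trans (⟦⟧-cong f (standard-column a i) x) (matrix-column f (vertex a i) x))

  standard-spans : ∀ {P : Expr → Set} → IsSubgroup P → (∀ a → P (standard a)) → ∀ {f} → Deg m f → P f
  standard-spans {P} P-sub p = ψ-spans P-sub m λ i i<m → subst (λ j → P (ψ j)) (opp i i<m)
      (p (opposite (fromℕ< i<m)))
    where
    opp : ∀ i (i<m : i < m) → toℕ (opposite (opposite (fromℕ< i<m))) ≡ i
    opp i i<m = trans (cong toℕ (Fin.opposite-involutive (fromℕ< i<m))) (toℕ-fromℕ< i<m)

  1∣ : ∀ z → 1ℤ ∣ z
  1∣ z = divides z (sym (ℤ.*-identityʳ z))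

  det-unit : ∀ {e f} → e ⊠ f ≋ con 1ℤ → det (matrix e) ∼ 1ℤ
  det-unit {e} {f} ef≋1 = divides (det (matrix f))
      (trans (sym det-matrix-1) (trans (sym (det-matrix-cong ef≋1))
    (trans (det-∙ (matrix e) (matrix f)) (ℤ.*-comm (det (matrix e)) (det (matrix f)))))) , 1∣ _

  module _ {d} (h : MonicDivisor (φ k) m d) where
    open MonicDivisor h renaming (divisor to H; cofactor to C; cofactor-degree to e)
    open IsSubgroup

    private
      -- With e the degree of the cofactor, F is h t^i, i < e, followed by x u t^j,
      -- j < d; in F′, the factor x is omitted.
      F F′ : ℕ → Expr
      F  = splice e (λ i → H ⊠ 𝕥 ↑ i) (λ j → 𝕩 ⊠ (u ⊠ 𝕥 ↑ j))
      F′ = splice e (λ i → H ⊠ 𝕥 ↑ i) (λ j → u ⊠ 𝕥 ↑ j)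
      B : ℕ → Matrix n n
      B = splice e (λ _ → identity) (λ _ → Q)

      H-standard : Fin m → Expr
      H-standard a = H ⊠ standard a

      member : ∀ f g {c} → c < m → Generated (λ a → splice e f g (toℕ a)) (splice e f g c)
      member f g c<m = subst (λ c → Generated (λ a → splice e f g (toℕ a)) (splice e f g c)) (toℕ-fromℕ< c<m)
        (generated-member (λ a → splice e f g (toℕ a)) (fromℕ< c<m))

      e≤m : e ≤ m
      e≤m = ℕ.≤-trans (ℕ.m≤m+n e d) (ℕ.≤-reflexive degrees)

      member-low : ∀ f g i → i < e → Generated (λ a → splice e f g (toℕ a)) (f i)
      member-low f g i i<e = subst (Generated (λ a → splice e f g (toℕ a))) (splice-< f g i<e)
          (member f g (ℕ.<-≤-trans i<e e≤m))

      member-high : ∀ f g j → j < d → Generated (λ a → splice e f g (toℕ a)) (g j)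
      member-high f g j j<d = subst (Generated (λ a → splice e f g (toℕ a))) (splice-+ e f g j)
        (member f g (ℕ.<-≤-trans (ℕ.+-monoʳ-< e j<d) (ℕ.≤-reflexive degrees)))

      F∣H-standard : det (family (F ∘ toℕ)) ∣ det (family H-standard)
      F∣H-standard = family-∣ {H-standard} {F ∘ toℕ} λ a →
        divisor-multiples (generated-isSubgroup (F ∘ toℕ)) h (member-low _ _) (member-high _ _)
            (standard-degree a)

      H-multiple : ∀ {f} → Deg m f → Generated H-standard (H ⊠ f)
      H-multiple = standard-spans (pullback H (generated-isSubgroup H-standard)) (generated-member H-standard)

      H-standard∣F : det (family H-standard) ∣ det (family (F ∘ toℕ))
      H-standard∣F = family-∣ {F ∘ toℕ} {H-standard} λ a → splice-all (Generated H-standard) e {d}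
        (λ i i<e → H-multiple (generator (i , ℕ.<-≤-trans i<e e≤m)))
        (λ j j<d → resp (generated-isSubgroup H-standard) (φ-multiple j)
            (H-multiple (cofactor-degree≤ h j<d (generator (j , ℕ.≤-refl)))))
        (toℕ a) (ℕ.<-≤-trans (toℕ<n a) (ℕ.≤-reflexive (sym degrees)))
        where
        φ-multiple : ∀ j → H ⊠ (C ⊠ 𝕥 ↑ j) ≋ 𝕩 ⊠ (u ⊠ 𝕥 ↑ j)
        φ-multiple j = equal λ v x → trans (at divisor*cofactor (⟦ 𝕥 ↑ j ⟧ v) x) (at φ≋xψ (⟦ 𝕥 ↑ j ⟧ v) x)

      F-columns : ∀ (a : Fin m) i → ⟦ F (toℕ a) ⟧ (layer 0 (δ i)) ≗ ⟦ F′ (toℕ a) ⟧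
          (layer 0 (λ j → B (toℕ a) j i))
      F-columns a i = go e (λ i → H ⊠ 𝕥 ↑ i) (toℕ a)
        where
        go : ∀ e f c → ⟦ splice e f (λ j → 𝕩 ⊠ (u ⊠ 𝕥 ↑ j)) c ⟧ (layer 0 (δ i)) ≗
                       ⟦ splice e f (λ j → u ⊠ 𝕥 ↑ j) c ⟧
                           (layer 0 (λ j → splice e (λ _ → identity) (λ _ → Q) c j i))
        go zero    f c       x = trans (𝕩-shift (u ⊠ 𝕥 ↑ c) (δ i) x)
            (⟦⟧-cong (u ⊠ 𝕥 ↑ c) (layer-cong 0 (·-identity Q i)) x)
        go (suc e) f zero    x = refl
        go (suc e) f (suc c) x = go e (f ∘ suc) c x

      det-F : det (family (F ∘ toℕ)) ≡ det (family (F′ ∘ toℕ)) * det Q ^ d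
      det-F = begin
        det (family (F ∘ toℕ))
          ≡⟨ det-cong {N} {family (F ∘ toℕ)} {family (F′ ∘ toℕ) ∙ blockDiagonal m B} (λ x y →
               trans (F-columns (quotient {m} n y) (remainder {m} n y) x)
                   (family-· (F′ ∘ toℕ) (quotient {m} n y)
                   (λ j → B (toℕ (quotient {m} n y)) j (remainder {m} n y)) x)) ⟩
        det (family (F′ ∘ toℕ) ∙ blockDiagonal m B)
          ≡⟨ det-∙ (family (F′ ∘ toℕ)) (blockDiagonal m B) ⟩
        det (family (F′ ∘ toℕ)) * det (blockDiagonal m B)
          ≡⟨ cong (det (family (F′ ∘ toℕ)) *_)
              (trans (det-blockDiagonal m B)
              (trans (cong (λ z → det-blocks z B) (sym degrees)) (det-blocks-splice e d Q))) ⟩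
        det (family (F′ ∘ toℕ)) * det Q ^ d ∎

      det-F′ : det (family (F′ ∘ toℕ)) ∼ 1ℤ
      det-F′ = ∣-trans (family-∣ {λ a → con 1ℤ ⊠ standard a} {F′ ∘ toℕ} λ a →
                 generates-everything (generated-isSubgroup (F′ ∘ toℕ))
                     (λ {f} → generated-𝕩 (F′ ∘ toℕ) {f}) h (member-low _ _) (member-high _ _)
                   (span-resp (R.sym (R.*-identityˡ (standard a))) (standard-degree a)))
                 (∣-reflexive (trans (family-standard (con 1ℤ)) det-matrix-1)) , 1∣ _

    -- The determinant of h is that of the family h ψ_a, which generates the same column
    -- space as F.  Passing from F to F′ splits off the factor 𝕩 in d of the
    -- blocks, and F′ generates everything.
    det-divisor : det (matrix H) ∼ det Q ^ d
    det-divisor = ∼-trans (∼-reflexive (sym (family-standard H))) (∼-trans (H-standard∣F , F∣H-standard)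
      (∼-trans (∼-reflexive det-F)
          (∼-trans (∼-* det-F′ (∼-reflexive refl)) (∼-reflexive (ℤ.*-identityˡ (det Q ^ d))))))

  𝟏 : Vector ℤ n
  𝟏 = replicate n 1ℤ

  u₀ : Vector ℤ N
  u₀ = layer 0 𝟏

  -- The walk of T that starts with the all-one vector of layer 0.
  layerWalk : Matrix N N
  layerWalk x y = ⟦ 𝕥 ↑ toℕ y ⟧ u₀ x

  W : Matrix n n
  W = Q-walkMatrix G

  𝕩^-u₀ : ∀ j → ⟦ 𝕩 ↑ j ⟧ u₀ ≗ layer 0 (fold 𝟏 (Q ·_) j)
  𝕩^-u₀ zero    x = ℤ.*-identityˡ (u₀ x)
  𝕩^-u₀ (suc j) x = trans (·-cong 𝑋 (𝕩^-u₀ j) x) (𝑋-layer 0 (fold 𝟏 (Q ·_) j) x)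

  -- The vectors X^j u₀, j < n, moved to each of the m blocks: diagonal blocks W.
  blockWalk : Matrix N N
  blockWalk = blockDiagonal m (λ _ → W)

  blockWalk-column : ∀ (a : Fin m) (j : Fin n) → ⟦ 𝕩 ↑ toℕ j ⊠ standard a ⟧ u₀ ≗ λ x → blockWalk x
      (vertex a j)
  blockWalk-column a j = combine-ind {m} {n}
      (λ x → ⟦ 𝕩 ↑ toℕ j ⊠ standard a ⟧ u₀ x ≡ blockWalk x (vertex a j)) λ b i → begin
    ⟦ 𝕩 ↑ toℕ j ⟧ (⟦ standard a ⟧ u₀) (vertex b i)     ≡⟨ ⟦⟧-comm (𝕩 ↑ toℕ j) (standard a) u₀ (vertex b i) ⟩
    ⟦ standard a ⟧ (⟦ 𝕩 ↑ toℕ j ⟧ u₀) (vertex b i)     ≡⟨ ⟦⟧-cong (standard a) (𝕩^-u₀ (toℕ j)) (vertex b i) ⟩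
    ⟦ standard a ⟧ (layer 0 w) (vertex b i)
      ≡⟨ ψ-layer (toℕ (opposite a)) w (toℕ<n (opposite a)) (vertex b i) ⟩
    layer (toℕ (opposite a)) w (vertex b i)            ≡⟨ layer-combine (toℕ (opposite a)) w b i ⟩
    far m (toℕ (opposite a)) (toℕ b) * W i j           ≡⟨ cong (_* W i j) (far-opposite a b) ⟩
    identity b a * W i j                               ≡⟨ blockDiagonal-combine {m} (λ _ → W) b a i j ⟨
    blockWalk (vertex b i) (vertex a j)                ∎
    where
    w : Vector ℤ n
    w = fold 𝟏 (Q ·_) (toℕ j)

  u^-unit : ∀ p → det (matrix (u ↑ p)) ∼ 1ℤ
  u^-unit zero    = ∼-reflexive det-matrix-1
  u^-unit (suc p) = ∼-trans (∼-reflexive (det-∙ (matrix u) (matrix (u ↑ p))))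
      (∼-* (det-unit (proj₂ (proj₂ (proj₂ (proj₂ u-unit))))) (u^-unit p))

  private
    -- The unit u^{n-1}.  For n = 0 the exponent is cut off at 0, but then the matrices
    -- have no columns.
    V : Expr
    V = u ↑ pred n

    suc-pred : Fin N → suc (pred n) ≡ n
    suc-pred y = ℕ.suc-pred n {{nonZeroIndex (remainder {m} n y)}}

    layerWalk∣ : det layerWalk ∣ det (matrix V ∙ blockWalk)
    layerWalk∣ = det-∣-det {A = layerWalk} {matrix V ∙ blockWalk} λ y → column y
      where
      low : ∀ {f} → Deg N f → ⟦ f ⟧ u₀ ∈col layerWalk
      low = span⊆ (col-isSubgroup layerWalk u₀) λ (i , i<N) →
        subst (λ i → ⟦ 𝕥 ↑ i ⟧ u₀ ∈col layerWalk) (toℕ-fromℕ< i<N) (∈col-column layerWalk (fromℕ< i<N))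
      column : ∀ y → (λ x → (matrix V ∙ blockWalk) x y) ∈col layerWalk
      column y = ∈col-resp layerWalk (λ x → trans (matrix-· V (⟦ 𝕩 ↑ toℕ j ⊠ standard a ⟧ u₀) x)
          (·-cong (matrix V)
              (λ z → trans (blockWalk-column a j z) (cong (blockWalk z) (Fin.combine-remQuot {m} n y))) x))
        (low (deg-≡ (cong (m ℕ.*_) (suc-pred y))
          (u^*box⇒deg (pred n) (toℕ j) (ℕ.s≤s⁻¹ (ℕ.≤-trans (toℕ<n j) (ℕ.≤-reflexive (sym (suc-pred y)))))
              (standard-degree a))))
        where
        a = quotient {m} n y
        j = remainder {m} n y

    ∣layerWalk : det (matrix V ∙ blockWalk) ∣ det layerWalk
    ∣layerWalk = det-∣-det {A = matrix V ∙ blockWalk} {layerWalk} λ y → column y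
      where
      box : ∀ {f} → Box n f → ⟦ f ⟧ u₀ ∈col blockWalk
      box = span⊆ (col-isSubgroup blockWalk u₀) λ ((j , j<n) , (i , i<m)) →
        standard-spans (pullback (𝕩 ↑ j) (col-isSubgroup blockWalk u₀))
          (λ a → subst (λ j → ⟦ 𝕩 ↑ j ⊠ standard a ⟧ u₀ ∈col blockWalk) (toℕ-fromℕ< j<n)
                   (∈col-resp blockWalk (λ x → sym (blockWalk-column a (fromℕ< j<n) x))
                       (∈col-column blockWalk (vertex a (fromℕ< j<n)))))
          (generator (i , i<m))
      column : ∀ y → (λ x → layerWalk x y) ∈col (matrix V ∙ blockWalk)
      column y = go
          (deg⇒u^*box (pred n)
          (generator (toℕ y , ℕ.<-≤-trans (toℕ<n y) (ℕ.≤-reflexive (cong (m ℕ.*_) (sym (suc-pred y)))))))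
        where
        go : (∃[ g ] Box (suc (pred n)) g × 𝕥 ↑ toℕ y ≋ V ⊠ g) → (λ x → layerWalk x y) ∈col
            (matrix V ∙ blockWalk)
        go (g , g∈ , eq) = ∈col-resp (matrix V ∙ blockWalk)
            (λ x → sym (trans (at eq u₀ x) (matrix-· V (⟦ g ⟧ u₀) x)))
          (∈col-∙ (matrix V) blockWalk (box (subst (λ z → Box z g) (suc-pred y) g∈)))

  det-layerWalk : det layerWalk ∼ det W ^ m
  det-layerWalk = ∼-trans (layerWalk∣ , ∣layerWalk)
    (∼-trans (∼-reflexive (det-∙ (matrix V) blockWalk))
    (∼-trans (∼-* (u^-unit (pred n))
        (∼-reflexive (trans (det-blockDiagonal m (λ _ → W)) (det-blocks-const m W))))
             (∼-reflexive (ℤ.*-identityˡ (det W ^ m)))))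

  -- Σψ s fills the last s vertices of each copy of the path with 1.
  Σψ-layer : ∀ s → s ≤ m → ∀ (b : Fin m) i → ⟦ Σψ s ⟧ u₀ (vertex b i) ≡ [ m ℕ.≤? toℕ b ℕ.+ s ]
  Σψ-layer zero    _   b i = trans (ℤ.*-zeroˡ (u₀ (vertex b i)))
    (sym ([]-no (m ℕ.≤? toℕ b ℕ.+ 0) (ℕ.<⇒≱ (ℕ.≤-<-trans (ℕ.≤-reflexive (ℕ.+-identityʳ (toℕ b))) (toℕ<n b)))))
  Σψ-layer (suc s) s<m b i = begin
    ⟦ Σψ s ⟧ u₀ (vertex b i) + ⟦ ψ s ⟧ u₀ (vertex b i)
      ≡⟨ cong₂ _+_ (Σψ-layer s (ℕ.<⇒≤ s<m) b i)
          (trans (ψ-layer s 𝟏 s<m (vertex b i))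
          (trans (layer-combine s 𝟏 b i) (ℤ.*-identityʳ (far m s (toℕ b))))) ⟩
    [ m ℕ.≤? c ] + [ toℕ b ℕ.+ suc s ℕ.≟ m ]
      ≡⟨ []-⊎ (m ℕ.≤? c) (toℕ b ℕ.+ suc s ℕ.≟ m) (λ m≤c e → ℕ.<-irrefl (sym e) (s≤c m≤c)) ⟨
    [ (m ℕ.≤? c) ⊎-dec (toℕ b ℕ.+ suc s ℕ.≟ m) ]
      ≡⟨ []-cong ((m ℕ.≤? c) ⊎-dec (toℕ b ℕ.+ suc s ℕ.≟ m)) (m ℕ.≤? toℕ b ℕ.+ suc s) to from ⟩
    [ m ℕ.≤? toℕ b ℕ.+ suc s ] ∎
    where
    c = toℕ b ℕ.+ s
    s≤c : m ≤ c → m < toℕ b ℕ.+ suc s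
    s≤c m≤c = ℕ.≤-trans (s≤s m≤c) (ℕ.≤-reflexive (sym (ℕ.+-suc (toℕ b) s)))
    to : m ≤ c ⊎ toℕ b ℕ.+ suc s ≡ m → m ≤ toℕ b ℕ.+ suc s
    to (inj₁ m≤c) = ℕ.<⇒≤ (s≤c m≤c)
    to (inj₂ e)   = ℕ.≤-reflexive (sym e)
    from : m ≤ toℕ b ℕ.+ suc s → m ≤ c ⊎ toℕ b ℕ.+ suc s ≡ m
    from m≤ with ℕ.m≤n⇒m<n∨m≡n m≤
    ... | inj₁ m< = inj₁ (ℕ.s≤s⁻¹ (ℕ.≤-trans m< (ℕ.≤-reflexive (ℕ.+-suc (toℕ b) s))))
    ... | inj₂ e  = inj₂ (sym e)

  ones : ⟦ Σψ m ⟧ u₀ ≗ λ _ → 1ℤ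
  ones = combine-ind {m} {n} (λ x → ⟦ Σψ m ⟧ u₀ x ≡ 1ℤ) λ b i →
    trans (Σψ-layer m ℕ.≤-refl b i) ([]-yes (m ℕ.≤? toℕ b ℕ.+ m) (ℕ.m≤n+m m (toℕ b)))

  -- The walk matrix of the rooted product.
  Ω : Matrix N N
  Ω = Q-walkMatrix (rootedProduct G (path m) zero)

  Ω-column : ∀ y → fold (replicate N 1ℤ) (𝑇 ·_) y ≗ ⟦ 𝕥 ↑ y ⟧ (⟦ Σψ m ⟧ u₀)
  Ω-column zero    x = sym (trans (ℤ.*-identityˡ _) (ones x))
  Ω-column (suc y) x = ·-cong 𝑇 (Ω-column y) x

  det-Ω : det Ω ≡ det (matrix (Σψ m)) * det layerWalk
  det-Ω = trans (det-cong {N} {Ω} {matrix (Σψ m) ∙ layerWalk} λ x y →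
      trans (Ω-column (toℕ y) x)
          (trans (⟦⟧-comm (𝕥 ↑ toℕ y) (Σψ m) u₀ x) (matrix-· (Σψ m) (⟦ 𝕥 ↑ toℕ y ⟧ u₀) x)))
    (det-∙ (matrix (Σψ m)) layerWalk)

  det-Σψ : det (matrix (Σψ m)) ∼ det Q ^ suc k
  det-Σψ = go (Σψ-factors k)
    where
    open MonicDivisor
    go : _ → det (matrix (Σψ m)) ∼ det Q ^ suc k
    go (d₁ , d₂ , (h₁ , h₂) , Σψ≈ , d₁+d₂) =
      ∼-trans (∼-reflexive
          (trans (det-matrix-cong {Σψ m} {divisor h₁ ⊠ divisor h₂} Σψ≈)
          (det-∙ (matrix (divisor h₁)) (matrix (divisor h₂)))))
      (∼-trans (∼-* (det-divisor h₁) (det-divisor h₂))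
               (∼-reflexive (trans (sym (ℤ.^-distribˡ-+-* (det Q) d₁ d₂)) (cong (det Q ^_) d₁+d₂))))

  det-walk : det Ω ∼ det Q ^ suc k * det W ^ m
  det-walk = ∼-trans (∼-reflexive det-Ω) (∼-* det-Σψ det-layerWalk)

theorem2 : (n : ℕ) (G : Graph n) (m : ℕ) (m≥2 : 2 ≤ m) →
    let
      G∘Pₘ = rootedProduct G (path m) (fromℕ< {0} (<⇒≤ m≥2))
      lhs  = det (Q-walkMatrix G∘Pₘ)
      rhs  = det (signlessLaplacian G) ^ (m ∸ 1) * det (Q-walkMatrix G) ^ m
    in lhs ≡ rhs ⊎ lhs ≡ - rhs
theorem2 n G (suc zero)    (s≤s ())
theorem2 n G (suc (suc k)) m≥2 = ∼⇒± (Main.det-walk G k)
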